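{- Let $X$ and $J$ be finite and let $f\in\mathcal L(X,J)$ be a generative formula. Then there is a continuum of cells of $\Omega(X,J)$ with finite fanout that are dense in $\mathbf{Ck}(\{f\})$.
   Context: Formulas. $X$ (primitive propositions) and $J$ (agents) are finite sets. $\mathcal L=\mathcal L(X,J)$ is the smallest set of formulas containing $X$ and closed under $g\mapsto\neg g$, $(g,h)\mapsto g\wedge h$, and $g\mapsto k_jg$ for $j\in J$; $g\vee h$ and $g\to h$ are the usual abbreviations ($g\to h$ is $\neg g\vee h$). The multi-agent S5 logic has the rules modus ponens and necessitation (if $g$ is a theorem so is $k_jg$) and as axioms all substitution instances of propositional theorems, $(k_jg\wedge k_j(g\to h))\to k_jh$, $k_jg\to g$, $k_jg\to k_jk_jg$, $\neg k_jg\to k_j\neg k_jg$. A set of formulas is consistent if no finite subset leads to a contradiction in this logic, and complete if for each formula $g$ it contains $g$ or $\neg g$. $\Omega=\Omega(X,J)$ is the set of all complete and consistent subsets of $\mathcal L$. Partitions, cells, topology. For $j\in J$, $\mathcal Q^j$ is the partition of $\Omega$ in which $z,z'$ are equivalent iff $\{g: k_jg\in z\}=\{g:k_jg\in z'\}$. A possibility set is a member of some $\mathcal Q^j$. A cell is a member of the meet partition $\bigwedge_{j\in J}\mathcal Q^j$, i.e. a minimal non-empty $C\subseteq\Omega$ such that $P\in\mathcal Q^j$ and $P\cap C\neq\emptyset$ imply $P\subseteq C$, for all $j$. A cell has finite fanout if every possibility set contained in it is finite. The topology of $\Omega$ has as base the sets $\{z\in\Omega: g\in z\}$, $g\in\mathcal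 L$. Let $E^0g=g$, $E g=\bigwedge_{j\in J}k_jg$, $E^{n}g=E(E^{n-1}g)$, and $\mathbf{Ck}(\{f\})=\{z\in\Omega: E^nf\in z\text{ for all }n\ge 0\}$. A cell $C$ is dense in $\mathbf{Ck}(\{f\})$ if $C\subseteq \mathbf{Ck}(\{f\})$ and $C$ is dense in it in the relative topology. Finite levels. Depth: $\mathrm{depth}(x)=0$ for $x\in X$, $\mathrm{depth}(\neg g)=\mathrm{depth}(g)$, $\mathrm{depth}(g\wedge h)=\max(\mathrm{depth}(g),\mathrm{depth}(h))$, $\mathrm{depth}(k_jg)=\mathrm{depth}(g)+1$. $\mathcal L_i$ is the set of formulas of depth $\le i$; $\Omega_i$ is the (finite) set of maximally consistent subsets of $\mathcal L_i$; $\pi_i:\Omega\to\Omega_i$, $\pi_i(z)=z\cap\mathcal L_i$ (surjective). $\mathcal G_i=\{\pi_i^{ -1}(w):w\in\Omega_i\}$. For $i\ge1$, $\overline{\mathcal F}_i^j$ is the partition of $\Omega_i$ in which $w,w'$ are equivalent iff $\{g\in\mathcal L_{i-1}:k_jg\in w\}=\{g\in\mathcal L_{i-1}:k_jg\in w'\}$; $\overline{\mathcal F}_0^j=\{\Omega_0\}$; $\mathcal F_i^j=\{\pi_i^{ -1}(B):B\in\overline{\mathcal F}_i^j\}$. For a formula $f$ of depth $d$, $\alpha^{\Omega_d}(f)=\{w\in\Omega_d:f\in w\}$. Generative formulas. For $i>0$ a non-empty $A\subseteq\Omega_i$ is semantically closed if for all $j\in J$, $B\in\mathcal G_{i-1}$,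 $w\in A$: if $\pi_i^{ -1}(w)\subseteq F\in\mathcal F_i^j$ and $F\cap B\ne\emptyset$ then $F\cap B\cap\pi_i^{ -1}(A)\neq\emptyset$. Every non-empty subset of $\Omega_0$ is semantically closed. A subset $A\subseteq\Omega_d$ is connected if any two of its elements are joined by a finite sequence in $A$ in which consecutive elements share a member of $\overline{\mathcal F}_d^j$ for some $j\in J$. A formula $f$ with $d=\mathrm{depth}(f)$ and $|J|\ge2$ is generative if $\alpha^{\Omega_d}(f)$ is semantically closed and connected, and there exists more than one cell dense in $\mathbf{Ck}(\{f\})$. -}

module Defs where

open import Data.Bool.Base as Bool using (Bool; true)
open import Data.Empty using (⊥; ⊥-elim)
open import Data.Fin.Base using (Fin; zero; suc)
open import Data.List.Base using (List; []; _∷_)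
import Data.List.Membership.Propositional as List
import Data.List.Relation.Unary.All as All
open import Data.List.Relation.Unary.All using (All; []; _∷_)
open import Data.List.Relation.Unary.Any using (Any; here; there)
open import Data.Nat.Base using (ℕ; zero; suc; _⊔_; _≤_)
open import Data.Product.Base using (Σ-syntax; ∃; ∃₂; ∃-syntax; _×_; _,_; proj₁; proj₂)
open import Data.Sum.Base using (_⊎_; inj₁; inj₂)
open import Data.Unit.Polymorphic.Base using (⊤)
open import Function.Bundles using (Func; Surjection; Bijection; _⇔_)
open import Level using (Level; 0ℓ) renaming (suc to lsuc; _⊔_ to _⊔ˡ_)
open import Relation.Binary.Bundles using (Setoid)
open import Relation.Binary.Core using (Rel)
open import Relation.Binary.Construct.Closure.ReflexiveTransitive using (Star)
open import Relation.Binary.PropositionalEquality using (_≡_; refl; _→-setoid_)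
open import Relation.Nullary.Negation using (¬_)
open import Relation.Unary
  using (Pred; _∈_; _⊆_; _≐_; _≬_; _∩_; Satisfiable) renaming (_⊢_ to preimage)
open import Relation.Unary.Properties using (≐-refl; ≐-sym; ≐-trans)

private
  variable
    a b c d ℓ ℓ₁ ℓ₂ : Level
    m n : ℕ

1ℓ : Level
1ℓ = lsuc 0ℓ

------------------------------------------------------------------------
-- Choice and cardinality, for sets presented as setoids

-- The section g must respect the setoid equalities; without that
-- requirement choice would be provable outright.
AxiomOfChoice : ∀ a b c d → Set (lsuc (a ⊔ˡ b ⊔ˡ c ⊔ˡ d))
AxiomOfChoice a b c d =
  {S : Setoid a b} {T : Setoid c d} (s : Surjection S T) →
  Σ[ g ∈ Func T S ]
    (∀ y → Setoid._≈_ T (Surjection.to s (Func.to g y)) y)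

HasCardinalityContinuum : Setoid a ℓ → Set (a ⊔ˡ ℓ)
HasCardinalityContinuum S = Bijection (ℕ →-setoid Bool) S

-- The members, at universe level ℓ₂, of the partition of A into the
-- classes of an equivalence relation.
Classes : {A : Set a} → Rel A ℓ₁ → Pred (Pred A ℓ₂) (a ⊔ˡ ℓ₁ ⊔ˡ ℓ₂)
Classes R P = ∃ λ x → P ≐ R x

------------------------------------------------------------------------
-- Formulas

infixr 6 _∧_
infixr 5 _∨_
infixr 4 _⇒_

data Formula (X J : Set) : Set where
  var : X → Formula X J
  ∼_  : Formula X J → Formula X J
  _∧_ : Formula X J → Formula X J → Formula X J
  K   : J → Formula X J → Formula X J

_∨_ : {X J : Set} → Formula X J → Formula X J → Formula X J
g ∨ h = ∼ ((∼ g) ∧ (∼ h))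

_⇒_ : {X J : Set} → Formula X J → Formula X J → Formula X J
g ⇒ h = (∼ g) ∨ h

depth : {X J : Set} → Formula X J → ℕ
depth (var x) = 0
depth (∼ g)   = depth g
depth (g ∧ h) = depth g ⊔ depth h
depth (K j g) = suc (depth g)

-- Finitely many primitive propositions and agents.
ℒ : ℕ → ℕ → Set
ℒ m n = Formula (Fin m) (Fin n)

⋀ : {X J : Set} → (Fin (suc n) → Formula X J) → Formula X J
⋀ {n = zero}  F = F zero
⋀ {n = suc _} F = F zero ∧ ⋀ (λ i → F (suc i))

-- For an empty set of agents the empty conjunction is rendered by the
-- theorem g ⇒ g; only the case of at least two agents matters below.
E : ℒ m n → ℒ m n
E {n = zero}  g = g ⇒ g
E {n = suc _} g = ⋀ (λ j → K j g)

E^ : ℕ → ℒ m n → ℒ m n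
E^ zero    g = g
E^ (suc i) g = E (E^ i g)

------------------------------------------------------------------------
-- The multi-agent S5 logic

PropFormula : Set
PropFormula = Formula ℕ ⊥

eval : (ℕ → Bool) → PropFormula → Bool
eval v (var x) = v x
eval v (∼ p)   = Bool.not (eval v p)
eval v (p ∧ q) = eval v p Bool.∧ eval v q

Tautology : PropFormula → Set
Tautology p = ∀ v → eval v p ≡ true

substitute : {X J : Set} → (ℕ → Formula X J) → PropFormula → Formula X J
substitute σ (var x) = σ x
substitute σ (∼ p)   = ∼ substitute σ p
substitute σ (p ∧ q) = substitute σ p ∧ substitute σ q

data Theorem {X J : Set} : Formula X J → Set where
  taut : ∀ p → Tautology p → ∀ σ → Theorem (substitute σ p)
  axK  : ∀ j g h → Theorem ((K j g ∧ K j (g ⇒ h)) ⇒ K j h)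
  axT  : ∀ j g → Theorem (K j g ⇒ g)
  ax4  : ∀ j g → Theorem (K j g ⇒ K j (K j g))
  ax5  : ∀ j g → Theorem ((∼ K j g) ⇒ K j (∼ K j g))
  mp   : ∀ {g h} → Theorem (g ⇒ h) → Theorem g → Theorem h
  nec  : ∀ {g} j → Theorem g → Theorem (K j g)

-- Deduction from premises: necessitation applies to theorems only.
infix 3 _⊩_

data _⊩_ {X J : Set} (Γ : List (Formula X J)) : Formula X J → Set where
  hyp : ∀ {g} → g List.∈ Γ → Γ ⊩ g
  thm : ∀ {g} → Theorem g → Γ ⊩ g
  mp  : ∀ {g h} → Γ ⊩ (g ⇒ h) → Γ ⊩ g → Γ ⊩ h

Consistent : {X J : Set} → Pred (Formula X J) ℓ → Set ℓ
Consistent S =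
  ¬ (∃[ Γ ] All S Γ × (∃[ g ] (Γ ⊩ g) × (Γ ⊩ ∼ g)))

Complete : {X J : Set} → Pred (Formula X J) ℓ → Set ℓ
Complete S = ∀ g → S g ⊎ S (∼ g)

------------------------------------------------------------------------
-- The space Ω, its possibility sets and its topology

record Ω (m n : ℕ) : Set 1ℓ where
  field
    ⟦_⟧        : Pred (ℒ m n) 0ℓ
    complete   : Complete ⟦_⟧
    consistent : Consistent ⟦_⟧

open Ω public using (⟦_⟧)

-- Points are sets of formulas, so they are equal when they have the
-- same members.
infix 4 _≈_
_≈_ : Rel (Ω m n) 0ℓ
z ≈ z′ = ⟦ z ⟧ ≐ ⟦ z′ ⟧

infix 4 _∼[_]_
_∼[_]_ : Ω m n → Fin n → Ω m n → Set
z ∼[ j ] z′ = (λ g → ⟦ z ⟧ (K j g)) ≐ (λ g → ⟦ z′ ⟧ (K j g))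

-- A subset of Ω is a predicate of level 1, the level of Ω itself. Under
-- excluded middle every predicate on Ω is equivalent to one of this level.
Subset : ℕ → ℕ → Set (lsuc 1ℓ)
Subset m n = Pred (Ω m n) 1ℓ

𝒬 : Fin n → Pred (Subset m n) 1ℓ
𝒬 j = Classes (_∼[ j ]_)

Saturated : Subset m n → Set (lsuc 1ℓ)
Saturated C = ∀ j P → P ∈ 𝒬 j → P ≬ C → P ⊆ C

record IsCell (C : Subset m n) : Set (lsuc 1ℓ) where
  field
    nonEmpty  : Satisfiable C
    saturated : Saturated C
    minimal   : ∀ D → Satisfiable D → Saturated D → D ⊆ C → C ⊆ D

Finite : Subset m n → Set 1ℓ
Finite P = ∃[ zs ] (∀ z → z ∈ P ⇔ Any (z ≈_) zs)

FiniteFanout : Subset m n → Set (lsuc 1ℓ)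
FiniteFanout C = ∀ j P → P ∈ 𝒬 j → P ⊆ C → Finite P

Basic : ℒ m n → Pred (Ω m n) 0ℓ
Basic g z = g ∈ ⟦ z ⟧

Open : Subset m n → Set 1ℓ
Open U = ∀ z → z ∈ U → ∃[ g ] z ∈ Basic g × Basic g ⊆ U

infix 4 _DenseIn_
_DenseIn_ : Subset m n → Pred (Ω m n) ℓ → Set (lsuc 1ℓ ⊔ˡ ℓ)
C DenseIn A = C ⊆ A × (∀ U → Open U → U ≬ A → U ≬ C)

Ck : ℒ m n → Pred (Ω m n) 0ℓ
Ck f z = ∀ i → E^ i f ∈ ⟦ z ⟧

------------------------------------------------------------------------
-- Finite levels

ℒ≤ : ℕ → Pred (ℒ m n) 0ℓ
ℒ≤ i g = depth g ≤ i

record Ω≤ (m n i : ℕ) : Set 1ℓ where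
  field
    ⟦_⟧ᵢ       : Pred (ℒ m n) 0ℓ
    bounded    : ⟦_⟧ᵢ ⊆ ℒ≤ i
    consistent : Consistent ⟦_⟧ᵢ
    maximal    : (S : Pred (ℒ m n) 0ℓ) → S ⊆ ℒ≤ i → Consistent S →
                 ⟦_⟧ᵢ ⊆ S → S ⊆ ⟦_⟧ᵢ

open Ω≤ public using (⟦_⟧ᵢ)

infix 4 _≈ᵢ_
_≈ᵢ_ : ∀ {i} → Rel (Ω≤ m n i) 0ℓ
w ≈ᵢ w′ = ⟦ w ⟧ᵢ ≐ ⟦ w′ ⟧ᵢ

π : ∀ i → Ω m n → Ω≤ m n i
π i z = record
  { ⟦_⟧ᵢ       = ⟦ z ⟧ ∩ ℒ≤ i
  ; bounded    = proj₂
  ; consistent = λ (Γ , Γ⊆ , contra) → Ω.consistent z (Γ , All.map proj₁ Γ⊆ , contra)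
  ; maximal    = maximal
  }
  where
  maximal : ∀ S → S ⊆ ℒ≤ i → Consistent S → (⟦ z ⟧ ∩ ℒ≤ i) ⊆ S → S ⊆ (⟦ z ⟧ ∩ ℒ≤ i)
  maximal S S⊆ con ⊆S {g} g∈S with Ω.complete z g
  ... | inj₁ g∈z  = g∈z , S⊆ g∈S
  ... | inj₂ ∼g∈z = ⊥-elim (con
    ( g ∷ (∼ g) ∷ [] , g∈S ∷ ⊆S (∼g∈z , S⊆ g∈S) ∷ []
    , g , hyp (here refl) , hyp (there (here refl)) ))

π⁻¹ : ∀ {i} → Pred (Ω≤ m n i) ℓ → Pred (Ω m n) ℓ
π⁻¹ {i = i} A = preimage (π i) A

𝒢 : ∀ i → Pred (Subset m n) 1ℓ
𝒢 {m} {n} i P = ∃ λ (w : Ω≤ m n i) → P ≐ π⁻¹ (w ≈ᵢ_)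

infix 4 _∼ᵢ[_]_
_∼ᵢ[_]_ : ∀ {i} → Ω≤ m n i → Fin n → Ω≤ m n i → Set
_∼ᵢ[_]_ {i = zero}  w j w′ = ⊤
_∼ᵢ[_]_ {i = suc i} w j w′ =
  (ℒ≤ i ∩ λ g → ⟦ w ⟧ᵢ (K j g)) ≐ (ℒ≤ i ∩ λ g → ⟦ w′ ⟧ᵢ (K j g))

ℱ̄ : ∀ i → Fin n → Pred (Pred (Ω≤ m n i) 1ℓ) 1ℓ
ℱ̄ i j = Classes (_∼ᵢ[ j ]_)

ℱ : ∀ i → Fin n → Pred (Subset m n) (lsuc 1ℓ)
ℱ {m = m} i j P = ∃[ B ] B ∈ ℱ̄ {m = m} i j × P ≐ π⁻¹ B

α : (f : ℒ m n) → Pred (Ω≤ m n (depth f)) 0ℓ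
α f w = f ∈ ⟦ w ⟧ᵢ

------------------------------------------------------------------------
-- Generative formulas

Closed : ∀ i → Pred (Ω≤ m n i) 0ℓ → Set (lsuc 1ℓ)
Closed zero    A = ⊤
Closed (suc i) A = ∀ j B w F → B ∈ 𝒢 i → w ∈ A → F ∈ ℱ (suc i) j →
  π⁻¹ (w ≈ᵢ_) ⊆ F → F ≬ B → Satisfiable (F ∩ B ∩ π⁻¹ A)

SemanticallyClosed : ∀ i → Pred (Ω≤ m n i) 0ℓ → Set (lsuc 1ℓ)
SemanticallyClosed i A = Satisfiable A × Closed i A

Connected : ∀ {i} → Pred (Ω≤ m n i) 0ℓ → Set (lsuc 1ℓ)
Connected {i = i} A = ∀ w w′ → w ∈ A → w′ ∈ A → Star Step w w′
  where
  Step : Rel _ _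
  Step u v = u ∈ A × v ∈ A ×
    (∃₂ λ j B → B ∈ ℱ̄ i j × u ∈ B × v ∈ B)

record Generative {m n : ℕ} (f : ℒ m n) : Set (lsuc 1ℓ) where
  field
    twoAgents          : 2 ≤ n
    semanticallyClosed : SemanticallyClosed (depth f) (α f)
    connected          : Connected (α f)
    twoDenseCells      : ∃₂ λ (C C′ : Subset m n) →
                         (IsCell C × C DenseIn Ck f) ×
                         (IsCell C′ × C′ DenseIn Ck f) × ¬ (C ≐ C′)

FiniteFanoutDenseCells : ℒ m n → Setoid (lsuc 1ℓ) 1ℓ
FiniteFanoutDenseCells {m} {n} f = record
  { Carrier = Σ[ C ∈ Subset m n ] IsCell C × FiniteFanout C × C DenseIn Ck f
  ; _≈_     = λ C D → proj₁ C ≐ proj₁ D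
  ; isEquivalence = record { refl = ≐-refl ; sym = ≐-sym ; trans = ≐-trans }
  }

{-# OPTIONS --safe #-}

-- Worlds labelled by points of Ck f can be glued along classes of an agent
-- whose members agree on K j g for g of depth below k, without changing the
-- truth of formulas of depth at most k. A branch s of the binary tree yields
-- an infinite chain of blocks, the i-th one being the quotient of Ck f by its
-- types of some finite depth (increasing with i), consecutive blocks being
-- glued along a class of one of two alternating agents. Classes meet at most two
-- blocks, so the theories of the worlds form a cell with finite fanout; it is
-- dense, since every formula is decided correctly in all late blocks. As two
-- dense cells exist, Ck f is infinite, so at each stage there are two choices
-- of the next block that lead to different theories of a fixed root world, and
-- s(i) decides between them. Different branches have different root theories,
-- but several of these may lie in one (countable) cell; König's diagonal
-- argument still extracts continuum many cells, and Cantor-Schröder-Bernstein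
-- finishes the proof.

module Submission where

open import Defs
open import Axiom.ExcludedMiddle using (ExcludedMiddle)
open import Data.Bool.Base as Bool using (Bool; true; false; not; if_then_else_)
open import Data.Bool.Properties using (¬-not; not-involutive; not-injective; ∧-zeroʳ)
open import Data.Empty using (⊥-elim)
open import Data.Fin.Base using (Fin; zero; suc; toℕ)
open import Data.Fin.Properties using (toℕ-injective; _≟_)
open import Data.List.Base using (List; []; _∷_; _++_; map; filter; allFin; cartesianProductWith)
open import Data.List.Membership.Propositional using (find; lose) renaming (_∈_ to _∈ₗ_)
open import Data.List.Membership.Propositional.Properties
  using (∈-map⁺; ∈-allFin; ∈-cartesianProductWith⁺; ∈-filter⁺; ∈-filter⁻)
open import Data.List.Relation.Unary.All as All using (All; []; _∷_)
import Data.List.Relation.Unary.All.Properties as All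
open import Data.List.Relation.Unary.Any as Any using (Any; here; there)
import Data.List.Relation.Unary.Any.Properties as Any
open import Data.Maybe.Base using (Maybe; just; nothing)
open import Data.Nat.Base
  using (ℕ; zero; suc; 2+; _+_; _≤_; _<_; z≤n; s≤s; _⊔_; _≤′_; ≤′-refl; ≤′-step)
open import Data.Nat.Properties hiding (_≟_)
open import Data.Product.Base hiding (map)
open import Data.Sum.Base using (_⊎_; inj₁; inj₂)
open import Data.Unit.Polymorphic.Base using (tt)
open import Function.Base using (_∘_; id; case_of_)
open import Function.Bundles using (mk⇔; Func; Surjection; Bijection; module Equivalence)
open import Level using (Level; 0ℓ; Lift; lift; lower) renaming (suc to lsuc; _⊔_ to _⊔ˡ_)
open import Relation.Binary.Bundles using (Setoid)
open import Relation.Binary.Core using (Rel)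
open import Relation.Binary.Construct.Closure.ReflexiveTransitive
  using (Star; ε; _◅_; _◅◅_; reverse; gmap; kleisliStar)
open import Relation.Binary.Structures using (IsEquivalence)
open import Relation.Binary.PropositionalEquality
  using (_≡_; refl; sym; trans; cong; cong₂; subst; subst₂; _≢_; _→-setoid_)
open import Relation.Nullary.Decidable.Core using (Dec; yes; no; does)
open import Relation.Nullary.Negation using (¬_)
open import Relation.Unary using (Pred; _⊆_; _∪_; _∩_; ｛_｝; Satisfiable)

-- Three obstacles shape the construction. A block of level `k` is connected only if any two points
-- of `Ck f` are joined by links that agree on `K j g` for `g` of depth below `k`, whereas
-- connectedness of `α f` concerns the depth of `f` alone. Semantic closure realises the finite
-- types by points of `Ck f`, and every link is then refined one depth at a time: a world inserted
-- between its ends yields theories that are linked to one more depth. The possibility set of a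
-- realised theory might contain limit points that no world realises. If the class of a world has
-- only finitely many theories, a single formula would separate such a point from all of them, which
-- is impossible. This is why blocks are quotients by finite types and why no class runs through
-- infinitely many blocks. A merge must not disturb formulas decided before. Hence the next gate is
-- the theory of the previous gate in the model built so far, and the level of a new block is at
-- least a bound that grows with each step and covers the formula telling the two choices apart.

private
  variable
    a b ℓ ℓ′ : Level
    X J : Set
    m n : ℕ

-- Numbering of formulas

double : ℕ → ℕ
double zero    = zero
double (suc k) = suc (suc (double k))

double-injective : ∀ {k l} → double k ≡ double l → k ≡ l
double-injective {zero}  {zero}  _  = refl
double-injective {suc k} {suc l} eq = cong suc (double-injective (suc-injective (suc-injective eq)))

odd≢even : ∀ k l → suc (double k) ≢ double l
odd≢even (suc k) (suc l) eq = odd≢even k l (suc-injective (suc-injective eq))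

opaque
  -- (k , l) ↦ 2ᵏ (2 l + 1)
  pair : ℕ → ℕ → ℕ
  pair zero    l = suc (double l)
  pair (suc k) l = double (pair k l)

  pair-injective : ∀ {k l k′ l′} → pair k l ≡ pair k′ l′ → k ≡ k′ × l ≡ l′
  pair-injective {k} {l} {k′} {l′} = injective k l k′ l′
    where
    injective : ∀ k l k′ l′ → pair k l ≡ pair k′ l′ → k ≡ k′ × l ≡ l′
    injective zero    l zero     l′ eq = refl , double-injective (suc-injective eq)
    injective zero    l (suc k′) l′ eq = ⊥-elim (odd≢even l (pair k′ l′) eq)
    injective (suc k) l zero     l′ eq = ⊥-elim (odd≢even l′ (pair k l) (sym eq))
    injective (suc k) l (suc k′) l′ eq = map₁ (cong suc) (injective k l k′ l′ (double-injective eq))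

code : ℒ m n → ℕ
code (var x) = pair 0 (toℕ x)
code (∼ g)   = pair 1 (code g)
code (g ∧ h) = pair 2 (pair (code g) (code h))
code (K j g) = pair 3 (pair (toℕ j) (code g))

code-injective : (g h : ℒ m n) → code g ≡ code h → g ≡ h
code-injective (var x) (var y) eq = cong var (toℕ-injective (proj₂ (pair-injective eq)))
code-injective (∼ g) (∼ h) eq = cong ∼_ (code-injective g h (proj₂ (pair-injective eq)))
code-injective (g ∧ g′) (h ∧ h′) eq with p , q ← pair-injective (proj₂ (pair-injective eq)) =
  cong₂ _∧_ (code-injective g h p) (code-injective g′ h′ q)
code-injective (K i g) (K j h) eq with p , q ← pair-injective (proj₂ (pair-injective eq)) =
  cong₂ K (toℕ-injective p) (code-injective g h q)
code-injective (var x) (∼ h) eq = case proj₁ (pair-injective eq) of λ ()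
code-injective (var x) (h ∧ h′) eq = case proj₁ (pair-injective eq) of λ ()
code-injective (var x) (K j h) eq = case proj₁ (pair-injective eq) of λ ()
code-injective (∼ g) (var y) eq = case proj₁ (pair-injective eq) of λ ()
code-injective (∼ g) (h ∧ h′) eq = case proj₁ (pair-injective eq) of λ ()
code-injective (∼ g) (K j h) eq = case proj₁ (pair-injective eq) of λ ()
code-injective (g ∧ g′) (var y) eq = case proj₁ (pair-injective eq) of λ ()
code-injective (g ∧ g′) (∼ h) eq = case proj₁ (pair-injective eq) of λ ()
code-injective (g ∧ g′) (K j h) eq = case proj₁ (pair-injective eq) of λ ()
code-injective (K i g) (var y) eq = case proj₁ (pair-injective eq) of λ ()
code-injective (K i g) (∼ h) eq = case proj₁ (pair-injective eq) of λ ()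
code-injective (K i g) (h ∧ h′) eq = case proj₁ (pair-injective eq) of λ ()

-- Booleans, propositional theorems and derivability

true-ext : ∀ {b c} → (b ≡ true → c ≡ true) → (c ≡ true → b ≡ true) → b ≡ c
true-ext {true}          f g = sym (f refl)
true-ext {false} {true}  f g = g refl
true-ext {false} {false} f g = refl

∧-true : ∀ {b c} → b Bool.∧ c ≡ true → b ≡ true × c ≡ true
∧-true {true} {true} _ = refl , refl

instantiate : Formula X J → Formula X J → Formula X J → ℕ → Formula X J
instantiate g h k 0 = g
instantiate g h k 1 = h
instantiate g h k _ = k

private
  p q r : PropFormula
  p = var 0
  q = var 1
  r = var 2

⇒-const : (g h : Formula X J) → Theorem (g ⇒ (h ⇒ g))
⇒-const g h = taut (p ⇒ (q ⇒ p)) t (instantiate g h h)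
  where
  t : Tautology (p ⇒ (q ⇒ p))
  t v with v 0 | v 1
  ... | true  | true  = refl
  ... | true  | false = refl
  ... | false | true  = refl
  ... | false | false = refl

⇒-refl : (g : Formula X J) → Theorem (g ⇒ g)
⇒-refl g = taut (p ⇒ p) t (instantiate g g g)
  where
  t : Tautology (p ⇒ p)
  t v with v 0
  ... | true  = refl
  ... | false = refl

⇒-dist : (g h k : Formula X J) → Theorem ((g ⇒ (h ⇒ k)) ⇒ ((g ⇒ h) ⇒ (g ⇒ k)))
⇒-dist g h k = taut ((p ⇒ (q ⇒ r)) ⇒ ((p ⇒ q) ⇒ (p ⇒ r))) t (instantiate g h k)
  where
  t : Tautology ((p ⇒ (q ⇒ r)) ⇒ ((p ⇒ q) ⇒ (p ⇒ r)))
  t v with v 0 | v 1 | v 2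
  ... | true  | true  | true  = refl
  ... | true  | true  | false = refl
  ... | true  | false | true  = refl
  ... | true  | false | false = refl
  ... | false | true  | true  = refl
  ... | false | true  | false = refl
  ... | false | false | true  = refl
  ... | false | false | false = refl

∼-elim : (g h : Formula X J) → Theorem (((∼ g) ⇒ h) ⇒ (((∼ g) ⇒ (∼ h)) ⇒ g))
∼-elim g h = taut (((∼ p) ⇒ q) ⇒ (((∼ p) ⇒ (∼ q)) ⇒ p)) t (instantiate g h h)
  where
  t : Tautology (((∼ p) ⇒ q) ⇒ (((∼ p) ⇒ (∼ q)) ⇒ p))
  t v with v 0 | v 1
  ... | true  | true  = refl
  ... | true  | false = refl
  ... | false | true  = refl
  ... | false | false = refl

∼-intro : (g h : Formula X J) → Theorem ((g ⇒ h) ⇒ ((g ⇒ (∼ h)) ⇒ (∼ g)))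
∼-intro g h = taut ((p ⇒ q) ⇒ ((p ⇒ (∼ q)) ⇒ (∼ p))) t (instantiate g h h)
  where
  t : Tautology ((p ⇒ q) ⇒ ((p ⇒ (∼ q)) ⇒ (∼ p)))
  t v with v 0 | v 1
  ... | true  | true  = refl
  ... | true  | false = refl
  ... | false | true  = refl
  ... | false | false = refl

∧-intro : (g h : Formula X J) → Theorem (g ⇒ (h ⇒ (g ∧ h)))
∧-intro g h = taut (p ⇒ (q ⇒ (p ∧ q))) t (instantiate g h h)
  where
  t : Tautology (p ⇒ (q ⇒ (p ∧ q)))
  t v with v 0 | v 1
  ... | true  | true  = refl
  ... | true  | false = refl
  ... | false | true  = refl
  ... | false | false = refl

∧-elimˡ : (g h : Formula X J) → Theorem ((g ∧ h) ⇒ g)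
∧-elimˡ g h = taut ((p ∧ q) ⇒ p) t (instantiate g h h)
  where
  t : Tautology ((p ∧ q) ⇒ p)
  t v with v 0 | v 1
  ... | true  | true  = refl
  ... | true  | false = refl
  ... | false | true  = refl
  ... | false | false = refl

∧-elimʳ : (g h : Formula X J) → Theorem ((g ∧ h) ⇒ h)
∧-elimʳ g h = taut ((p ∧ q) ⇒ q) t (instantiate g h h)
  where
  t : Tautology ((p ∧ q) ⇒ q)
  t v with v 0 | v 1
  ... | true  | true  = refl
  ... | true  | false = refl
  ... | false | true  = refl
  ... | false | false = refl

infix 3 _⊢_

-- Premises form a predicate rather than a list, so that the deduction theorem is a plain recursion
-- on derivations; `⊩⇒⊢` and `⊢⇒⊩` relate it to `_⊩_`.
data _⊢_ (S : Pred (Formula X J) ℓ) : Formula X J → Set ℓ where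
  hyp : ∀ {g} → S g → S ⊢ g
  thm : ∀ {g} → Theorem g → S ⊢ g
  mp  : ∀ {g h} → S ⊢ (g ⇒ h) → S ⊢ g → S ⊢ h

Inconsistent : Pred (Formula X J) ℓ → Set ℓ
Inconsistent S = ∃ λ g → (S ⊢ g) × (S ⊢ ∼ g)

weaken : {S : Pred (Formula X J) ℓ} {T : Pred (Formula X J) ℓ′} {g : Formula X J} →
         S ⊆ T → S ⊢ g → T ⊢ g
weaken S⊆T (hyp x)  = hyp (S⊆T x)
weaken S⊆T (thm t)  = thm t
weaken S⊆T (mp d e) = mp (weaken S⊆T d) (weaken S⊆T e)

inconsistent-mono : {S : Pred (Formula X J) ℓ} {T : Pred (Formula X J) ℓ′} →
                    S ⊆ T → Inconsistent S → Inconsistent T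
inconsistent-mono S⊆T (g , d , e) = g , weaken S⊆T d , weaken S⊆T e

⊩⇒⊢ : {S : Pred (Formula X J) ℓ} {Γ : List (Formula X J)} {g : Formula X J} →
      All S Γ → Γ ⊩ g → S ⊢ g
⊩⇒⊢ Γ⊆S (hyp x)  = hyp (All.lookup Γ⊆S x)
⊩⇒⊢ Γ⊆S (thm t)  = thm t
⊩⇒⊢ Γ⊆S (mp d e) = mp (⊩⇒⊢ Γ⊆S d) (⊩⇒⊢ Γ⊆S e)

⊩-weaken : {Γ Δ : List (Formula X J)} {g : Formula X J} →
           (∀ {h} → h ∈ₗ Γ → h ∈ₗ Δ) → Γ ⊩ g → Δ ⊩ g
⊩-weaken Γ⊆Δ (hyp x)  = hyp (Γ⊆Δ x)
⊩-weaken Γ⊆Δ (thm t)  = thm t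
⊩-weaken Γ⊆Δ (mp d e) = mp (⊩-weaken Γ⊆Δ d) (⊩-weaken Γ⊆Δ e)

⊢⇒⊩ : {S : Pred (Formula X J) ℓ} {g : Formula X J} →
      S ⊢ g → ∃ λ Γ → All S Γ × (Γ ⊩ g)
⊢⇒⊩ (hyp {g} x) = g ∷ [] , x ∷ [] , hyp (here refl)
⊢⇒⊩ (thm t)     = [] , [] , thm t
⊢⇒⊩ (mp d e) with Γ , Γ⊆S , d′ ← ⊢⇒⊩ d | Δ , Δ⊆S , e′ ← ⊢⇒⊩ e =
  Γ ++ Δ , All.++⁺ Γ⊆S Δ⊆S ,
  mp (⊩-weaken Any.++⁺ˡ d′) (⊩-weaken (Any.++⁺ʳ Γ) e′)

consistent⁻ : {S : Pred (Formula X J) ℓ} → Consistent S → ¬ Inconsistent S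
consistent⁻ con (g , d , e) with Γ , Γ⊆S , d′ ← ⊢⇒⊩ d | Δ , Δ⊆S , e′ ← ⊢⇒⊩ e =
  con (Γ ++ Δ , All.++⁺ Γ⊆S Δ⊆S , g ,
       ⊩-weaken Any.++⁺ˡ d′ , ⊩-weaken (Any.++⁺ʳ Γ) e′)

consistent⁺ : {S : Pred (Formula X J) ℓ} → ¬ Inconsistent S → Consistent S
consistent⁺ con (Γ , Γ⊆S , g , d , e) = con (g , ⊩⇒⊢ Γ⊆S d , ⊩⇒⊢ Γ⊆S e)

deduction : {S : Pred (Formula X J) ℓ} {g h : Formula X J} →
            S ∪ ｛ g ｝ ⊢ h → S ⊢ g ⇒ h
deduction {g = g} (hyp {h} (inj₁ x))  = mp (thm (⇒-const h g)) (hyp x)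
deduction {g = g} (hyp (inj₂ refl))   = thm (⇒-refl g)
deduction {g = g} (thm {h} t)         = mp (thm (⇒-const h g)) (thm t)
deduction {g = g} (mp {h} {k} d e)    =
  mp (mp (thm (⇒-dist g h k)) (deduction d)) (deduction e)

cut : {S : Pred (Formula X J) ℓ} (g : Formula X J) →
      Inconsistent (S ∪ ｛ g ｝) → Inconsistent (S ∪ ｛ ∼ g ｝) → Inconsistent S
cut g (h , d , e) (h′ , d′ , e′) = g ,
  mp (mp (thm (∼-elim g h′)) (deduction d′)) (deduction e′) ,
  mp (mp (thm (∼-intro g h)) (deduction d)) (deduction e)

inΩ : (z : Ω m n) {g : ℒ m n} → ⟦ z ⟧ ⊢ g → ⟦ z ⟧ g
inΩ z {g} d with Ω.complete z g
... | inj₁ g∈z  = g∈z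
... | inj₂ ∼g∈z = ⊥-elim (consistent⁻ (Ω.consistent z) (g , d , hyp ∼g∈z))

K-mp : (z : Ω m n) (j : Fin n) {g h : ℒ m n} →
       ⟦ z ⟧ ⊢ K j (g ⇒ h) → ⟦ z ⟧ ⊢ K j g → ⟦ z ⟧ ⊢ K j h
K-mp z j {g} {h} d e = mp (thm (axK j g h)) (mp (mp (thm (∧-intro _ _)) e) d)

-- Lindenbaum's lemma and the points of `Ω`

module Classical (em : ∀ {ℓ} → ExcludedMiddle ℓ) where

  dne : {A : Set a} → ¬ ¬ A → A
  dne {A = A} ¬¬a with em {P = A}
  ... | yes a = a
  ... | no ¬a = ⊥-elim (¬¬a ¬a)

  ¬∀⇒∃¬ : {A : Set a} {P : A → Set b} → ¬ (∀ x → P x) → ∃ λ x → ¬ P x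
  ¬∀⇒∃¬ ¬∀ = dne λ ¬∃ → ¬∀ λ x → dne λ ¬p → ¬∃ (x , ¬p)

  opaque
    ⌊_⌋ : Set a → Bool
    ⌊ A ⌋ = does (em {P = A})

    ⌊⌋-true : {A : Set a} → A → ⌊ A ⌋ ≡ true
    ⌊⌋-true {A = A} x with em {P = A}
    ... | yes _ = refl
    ... | no ¬x = ⊥-elim (¬x x)

    ⌊⌋-false : {A : Set a} → ¬ A → ⌊ A ⌋ ≡ false
    ⌊⌋-false {A = A} ¬x with em {P = A}
    ... | yes x = ⊥-elim (¬x x)
    ... | no _  = refl

    true-⌊⌋ : {A : Set a} → ⌊ A ⌋ ≡ true → A
    true-⌊⌋ {A = A} eq with em {P = A}
    ... | yes x = x

    false-⌊⌋ : {A : Set a} → ⌊ A ⌋ ≡ false → ¬ A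
    false-⌊⌋ {A = A} eq with em {P = A}
    ... | no ¬x = ¬x

  ⌊⌋-cong : {A : Set a} {B : Set b} → (A → B) → (B → A) → ⌊ A ⌋ ≡ ⌊ B ⌋
  ⌊⌋-cong f g = true-ext (⌊⌋-true ∘ f ∘ true-⌊⌋) (⌊⌋-true ∘ g ∘ true-⌊⌋)

  module Lindenbaum {m n} (S : Pred (ℒ m n) 0ℓ) (con : ¬ Inconsistent S) where

    Stage : ℕ → Pred (ℒ m n) 0ℓ
    Stage zero    = S
    Stage (suc k) g = Stage k g ⊎ (code g ≡ k × ¬ Inconsistent (Stage k ∪ ｛ g ｝))

    Limit : Pred (ℒ m n) 0ℓ
    Limit g = ∃ λ k → Stage k g

    stage-mono′ : ∀ {k l} → k ≤′ l → Stage k ⊆ Stage l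
    stage-mono′ ≤′-refl       x = x
    stage-mono′ (≤′-step k≤l) x = inj₁ (stage-mono′ k≤l x)

    stage-mono : ∀ {k l} → k ≤ l → Stage k ⊆ Stage l
    stage-mono k≤l = stage-mono′ (≤⇒≤′ k≤l)

    -- Since `code` is injective, a stage adds at most one formula, and only one that is consistent
    -- with the stage before.
    stage-con : ∀ k → ¬ Inconsistent (Stage k)
    stage-con zero    inc = con inc
    stage-con (suc k) inc with em {P = ∃ λ g → code g ≡ k × ¬ Inconsistent (Stage k ∪ ｛ g ｝)}
    ... | yes (g , refl , c) = c (inconsistent-mono sub inc)
      where
      sub : Stage (suc k) ⊆ Stage k ∪ ｛ g ｝
      sub (inj₁ x)            = inj₁ x
      sub {h} (inj₂ (eq , _)) = inj₂ (sym (code-injective h g eq))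
    ... | no ¬ex = stage-con k (inconsistent-mono sub inc)
      where
      sub : Stage (suc k) ⊆ Stage k
      sub (inj₁ x) = x
      sub (inj₂ p) = ⊥-elim (¬ex (_ , p))

    compact : ∀ {g} → Limit ⊢ g → ∃ λ k → Stage k ⊢ g
    compact (hyp (k , x)) = k , hyp x
    compact (thm t)       = 0 , thm t
    compact (mp d e) with k , d′ ← compact d | l , e′ ← compact e =
      k ⊔ l , mp (weaken (stage-mono (m≤m⊔n k l)) d′) (weaken (stage-mono (m≤n⊔m k l)) e′)

    limit-con : ¬ Inconsistent Limit
    limit-con (g , d , e) with k , d′ ← compact d | l , e′ ← compact e =
      stage-con (k ⊔ l) (g , weaken (stage-mono (m≤m⊔n k l)) d′ , weaken (stage-mono (m≤n⊔m k l)) e′)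

    limit-complete : Complete Limit
    limit-complete g with em {P = Limit g} | em {P = Limit (∼ g)}
    ... | yes x | _     = inj₁ x
    ... | no _  | yes y = inj₂ y
    ... | no ¬x | no ¬y = ⊥-elim (stage-con l (cut g (lift-inc (m≤m⊔n _ _) inc) (lift-inc (m≤n⊔m _ _) inc′)))
      where
      l = code g ⊔ code (∼ g)
      inc : Inconsistent (Stage (code g) ∪ ｛ g ｝)
      inc = dne λ c → ¬x (suc (code g) , inj₂ (refl , c))
      inc′ : Inconsistent (Stage (code (∼ g)) ∪ ｛ ∼ g ｝)
      inc′ = dne λ c → ¬y (suc (code (∼ g)) , inj₂ (refl , c))
      lift-inc : ∀ {k h} → k ≤ l → Inconsistent (Stage k ∪ ｛ h ｝) → Inconsistent (Stage l ∪ ｛ h ｝)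
      lift-inc k≤l = inconsistent-mono λ where
        (inj₁ x) → inj₁ (stage-mono k≤l x)
        (inj₂ y) → inj₂ y

    point : Ω m n
    point = record { ⟦_⟧ = Limit ; complete = limit-complete ; consistent = consistent⁺ limit-con }

  opaque
    lindenbaum : {S : Pred (ℒ m n) 0ℓ} → ¬ Inconsistent S → ∃ λ (z : Ω m n) → S ⊆ ⟦ z ⟧
    lindenbaum {S = S} con = Lindenbaum.point S con , λ x → 0 , x

  val : Ω m n → ℒ m n → Bool
  val z g = ⌊ ⟦ z ⟧ g ⌋

  val-∼ : (z : Ω m n) (g : ℒ m n) → val z (∼ g) ≡ not (val z g)
  val-∼ z g with Ω.complete z g
  ... | inj₁ x = trans (⌊⌋-false λ y → consistent⁻ (Ω.consistent z) (g , hyp x , hyp y))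
    (cong not (sym (⌊⌋-true x)))
  ... | inj₂ y = trans (⌊⌋-true y) (cong not (sym (⌊⌋-false λ x →
    consistent⁻ (Ω.consistent z) (g , hyp x , hyp y))))

  val-∧ : (z : Ω m n) (g h : ℒ m n) → val z (g ∧ h) ≡ val z g Bool.∧ val z h
  val-∧ z g h = true-ext
    (λ eq → cong₂ Bool._∧_
      (⌊⌋-true (inΩ z (mp (thm (∧-elimˡ g h)) (hyp (true-⌊⌋ eq)))))
      (⌊⌋-true (inΩ z (mp (thm (∧-elimʳ g h)) (hyp (true-⌊⌋ eq))))))
    (λ eq → let x , y = ∧-true eq in
      ⌊⌋-true (inΩ z (mp (mp (thm (∧-intro g h)) (hyp (true-⌊⌋ x))) (hyp (true-⌊⌋ y)))))

  infix 4 _≋_ _∼⟨_,_⟩_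

  _≋_ : Ω m n → Ω m n → Set
  z ≋ z′ = ∀ g → val z g ≡ val z′ g

  ≈⇒≋ : {z z′ : Ω m n} → z ≈ z′ → z ≋ z′
  ≈⇒≋ (f , g) _ = ⌊⌋-cong f g

  ≋⇒≈ : {z z′ : Ω m n} → z ≋ z′ → z ≈ z′
  ≋⇒≈ eq = (λ x → true-⌊⌋ (trans (sym (eq _)) (⌊⌋-true x)))
         , (λ x → true-⌊⌋ (trans (eq _) (⌊⌋-true x)))

  ∼ⱼ⇒val : {j : Fin n} {z z′ : Ω m n} → z ∼[ j ] z′ → ∀ g → val z (K j g) ≡ val z′ (K j g)
  ∼ⱼ⇒val (f , g) _ = ⌊⌋-cong f g

  val⇒∼ⱼ : {j : Fin n} {z z′ : Ω m n} → (∀ g → val z (K j g) ≡ val z′ (K j g)) → z ∼[ j ] z′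
  val⇒∼ⱼ eq = (λ x → true-⌊⌋ (trans (sym (eq _)) (⌊⌋-true x)))
            , (λ x → true-⌊⌋ (trans (eq _) (⌊⌋-true x)))

  K-reflexive : (z : Ω m n) (j : Fin n) (g : ℒ m n) → val z (K j g) ≡ true → val z g ≡ true
  K-reflexive z j g eq = ⌊⌋-true (inΩ z (mp (thm (axT j g)) (hyp (true-⌊⌋ eq))))

  -- The existence lemma of the canonical model. The set of all `h` known at `z`, with `∼ g` added,
  -- is consistent: by `known`, a contradiction derived from it would put `K j g` into `z`. Axioms
  -- `ax4` and `ax5` make any complete extension know exactly what `z` knows.
  K-witness : (z : Ω m n) (j : Fin n) (g : ℒ m n) → val z (K j g) ≡ false →
              ∃ λ z′ → (∀ h → val z (K j h) ≡ val z′ (K j h)) × val z′ g ≡ false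
  K-witness {m} {n} z j g Kg∉z = z′ , same ,
    trans (sym (not-involutive _))
      (cong not (trans (sym (val-∼ z′ g)) (⌊⌋-true (S⊆z′ (inj₂ refl)))))
    where
    S : Pred (ℒ m n) 0ℓ
    S = (λ h → ⟦ z ⟧ (K j h)) ∪ ｛ ∼ g ｝

    known : ∀ {h} → S ⊢ h → ⟦ z ⟧ ⊢ K j ((∼ g) ⇒ h)
    known (hyp {h} (inj₁ x)) = K-mp z j (thm (nec j (⇒-const h (∼ g)))) (hyp x)
    known (hyp (inj₂ refl))  = thm (nec j (⇒-refl (∼ g)))
    known (thm {h} t)        = thm (nec j (mp (⇒-const h (∼ g)) t))
    known (mp {h} {k} d e)   =
      K-mp z j (K-mp z j (thm (nec j (⇒-dist (∼ g) h k))) (known d)) (known e)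

    extension : ∃ λ z′ → S ⊆ ⟦ z′ ⟧
    extension = lindenbaum λ (h , d , e) → false-⌊⌋ Kg∉z (inΩ z
      (K-mp z j (K-mp z j (thm (nec j (∼-elim g h))) (known d)) (known e)))

    z′ = proj₁ extension
    S⊆z′ : S ⊆ ⟦ z′ ⟧
    S⊆z′ = proj₂ extension

    same : ∀ h → val z (K j h) ≡ val z′ (K j h)
    same h = true-ext
      (λ eq → ⌊⌋-true (S⊆z′ (inj₁ (inΩ z (mp (thm (ax4 j h)) (hyp (true-⌊⌋ eq)))))))
      (λ eq → ¬-not λ ¬x → consistent⁻ (Ω.consistent z′)
        (K j h , hyp (true-⌊⌋ eq) ,
         hyp (S⊆z′ (inj₁ (inΩ z (mp (thm (ax5 j h)) (hyp
           (true-⌊⌋ (trans (val-∼ z (K j h)) (cong not ¬x))))))))))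

  -- The strict bound on `g` makes `K j g` a formula of depth at most `k`, so this is agent `j`'s
  -- relation on types of depth `k`; at `k = 0` it relates all points.
  _∼⟨_,_⟩_ : Ω m n → ℕ → Fin n → Ω m n → Set
  u ∼⟨ k , j ⟩ v = ∀ g → depth g < k → val u (K j g) ≡ val v (K j g)

-- Kripke models, theories of worlds and types of bounded depth

module Models (em : ∀ {ℓ} → ExcludedMiddle ℓ) {m n : ℕ} where
  open Classical em

  record Model : Set₂ where
    field
      W     : Set₁
      R     : Fin n → Rel W 0ℓ
      equiv : ∀ j → IsEquivalence (R j)
      V     : W → Fin m → Bool

    module ≡R j = IsEquivalence (equiv j)

    -- Boolean values keep theories of worlds at level 0, although the clause for `K` quantifies
    -- over worlds in `Set₁`.
    sat : W → ℒ m n → Bool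
    sat x (var i) = V x i
    sat x (∼ g)   = not (sat x g)
    sat x (g ∧ h) = sat x g Bool.∧ sat x h
    sat x (K j g) = ⌊ (∀ y → R j x y → sat y g ≡ true) ⌋

    sat-K : ∀ {x y} j g → R j x y → sat x (K j g) ≡ true → sat y g ≡ true
    sat-K j g r eq = true-⌊⌋ eq _ r

    sat-¬K : ∀ {x} j g → sat x (K j g) ≡ false → ∃ λ y → R j x y × sat y g ≡ false
    sat-¬K {x} j g eq = dne λ ¬∃ → false-⌊⌋ eq λ y r → ¬-not λ eq′ → ¬∃ (y , r , eq′)

    sat-K-cong : ∀ {x y} j g → R j x y → sat x (K j g) ≡ sat y (K j g)
    sat-K-cong j g r = ⌊⌋-cong
      (λ k z r′ → k z (≡R.trans j r r′))
      (λ k z r′ → k z (≡R.trans j (≡R.sym j r) r′))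

    sat-substitute : ∀ σ p x → sat x (substitute σ p) ≡ eval (λ i → sat x (σ i)) p
    sat-substitute σ (var i) x = refl
    sat-substitute σ (∼ p)   x = cong not (sat-substitute σ p x)
    sat-substitute σ (p ∧ q) x = cong₂ Bool._∧_ (sat-substitute σ p x) (sat-substitute σ q x)

    sat-mp : ∀ x g h → sat x (g ⇒ h) ≡ true → sat x g ≡ true → sat x h ≡ true
    sat-mp x g h _  _ with sat x g | sat x h
    ... | true | true = refl

    sat-⇒ : ∀ x g h → (sat x g ≡ true → sat x h ≡ true) → sat x (g ⇒ h) ≡ true
    sat-⇒ x g h f with sat x g | sat x h
    ... | true  | true  = refl
    ... | true  | false = f refl
    ... | false | true  = refl
    ... | false | false = refl

    sound : ∀ {g} → Theorem g → ∀ x → sat x g ≡ true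
    sound (taut p t σ) x = trans (sat-substitute σ p x) (t _)
    sound (axK j g h)  x = sat-⇒ x (K j g ∧ K j (g ⇒ h)) (K j h) λ eq →
      let Kg , Kgh = ∧-true eq in
      ⌊⌋-true λ y r → sat-mp y g h (sat-K j (g ⇒ h) r Kgh) (sat-K j g r Kg)
    sound (axT j g)    x = sat-⇒ x (K j g) g (sat-K j g (≡R.refl j))
    sound (ax4 j g)    x = sat-⇒ x (K j g) (K j (K j g)) λ eq →
      ⌊⌋-true λ y r → trans (sym (sat-K-cong j g r)) eq
    sound (ax5 j g)    x = sat-⇒ x (∼ K j g) (K j (∼ K j g)) λ eq →
      ⌊⌋-true λ y r → trans (cong not (sym (sat-K-cong j g r))) eq
    sound (mp {g} {h} s t) x = sat-mp x g h (sound s x) (sound t x)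
    sound (nec j t)    x = ⌊⌋-true λ y _ → sound t y

    sound-⊢ : ∀ x {g} → (λ h → sat x h ≡ true) ⊢ g → sat x g ≡ true
    sound-⊢ x (hyp eq)         = eq
    sound-⊢ x (thm t)          = sound t x
    sound-⊢ x (mp {g} {h} d e) = sat-mp x g h (sound-⊢ x d) (sound-⊢ x e)

    th : W → Ω m n
    th x = record
      { ⟦_⟧        = λ g → sat x g ≡ true
      ; complete   = complete
      ; consistent = consistent⁺ λ (g , d , e) →
          case trans (sym (sound-⊢ x e)) (cong not (sound-⊢ x d)) of λ ()
      }
      where
      complete : ∀ g → (sat x g ≡ true) ⊎ (not (sat x g) ≡ true)
      complete g with sat x g
      ... | true  = inj₁ refl
      ... | false = inj₂ refl

    val-th : ∀ x g → val (th x) g ≡ sat x g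
    val-th x g with sat x g
    ... | true  = ⌊⌋-true refl
    ... | false = ⌊⌋-false λ ()

    th-R : ∀ {x y} j → R j x y → ∀ g → val (th x) (K j g) ≡ val (th y) (K j g)
    th-R {x} {y} j r g =
      trans (val-th x (K j g)) (trans (sat-K-cong j g r) (sym (val-th y (K j g))))

    -- Labels need to behave like theories only up to depth `k`. If `K j g` holds at a label,
    -- `forth` carries it to every related label, where reflexivity gives `g`; if it fails, `back`
    -- supplies a world refuting `g`.
    truth : ∀ k (l : W → Ω m n) →
            (∀ x i → V x i ≡ val (l x) (var i)) →
            (∀ j {x y} → R j x y → l x ∼⟨ k , j ⟩ l y) →
            (∀ j x g → depth g < k → val (l x) (K j g) ≡ false →
               ∃ λ y → R j x y × val (l y) g ≡ false) →
            ∀ g x → depth g ≤ k → sat x g ≡ val (l x) g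
    truth k l vars forth back = go
      where
      go : ∀ g x → depth g ≤ k → sat x g ≡ val (l x) g
      go (var i) x _ = vars x i
      go (∼ g) x d≤k = trans (cong not (go g x d≤k)) (sym (val-∼ (l x) g))
      go (g ∧ h) x d≤k =
        trans (cong₂ Bool._∧_ (go g x (m⊔n≤o⇒m≤o _ _ d≤k)) (go h x (m⊔n≤o⇒n≤o _ _ d≤k)))
              (sym (val-∧ (l x) g h))
      go (K j g) x d<k with val (l x) (K j g) in eq
      ... | true  = ⌊⌋-true λ y r → trans (go g y (<⇒≤ d<k))
                      (K-reflexive (l y) j g (trans (sym (forth j r g d<k)) eq))
      ... | false = ⌊⌋-false λ k → case back j x g d<k eq of λ where
                      (y , r , eq′) → case trans (sym (k y r)) (trans (go g y (<⇒≤ d<k)) eq′) of λ ()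

  ∼⟨⟩-trans : ∀ {u v w : Ω m n} {k j} → u ∼⟨ k , j ⟩ v → v ∼⟨ k , j ⟩ w → u ∼⟨ k , j ⟩ w
  ∼⟨⟩-trans p q g d<k = trans (p g d<k) (q g d<k)

  ∼⟨⟩-sym : ∀ {u v : Ω m n} {k j} → u ∼⟨ k , j ⟩ v → v ∼⟨ k , j ⟩ u
  ∼⟨⟩-sym p g d<k = sym (p g d<k)

  Agree : List (ℒ m n) → Rel (Ω m n) 0ℓ
  Agree Φ u v = All (λ φ → val u φ ≡ val v φ) Φ

  -- The formula g is arbitrary; it serves to express the empty conjunction.
  patterns : ℒ m n → List (ℒ m n) → List (ℒ m n)
  patterns g []      = (g ⇒ g) ∷ []
  patterns g (φ ∷ Φ) = map (φ ∧_) (patterns g Φ) ++ map ((∼ φ) ∧_) (patterns g Φ)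

  pattern-of : ∀ g Φ (z : Ω m n) →
    ∃ λ χ → χ ∈ₗ patterns g Φ × val z χ ≡ true × (∀ y → val y χ ≡ true → Agree Φ z y)
  pattern-of g [] z = (g ⇒ g) , here refl , ⌊⌋-true (inΩ z (thm (⇒-refl g))) , λ _ _ → []
  pattern-of g (φ ∷ Φ) z with pattern-of g Φ z | val z φ in eq
  ... | χ , χ∈ , zχ , agree | true  = φ ∧ χ , Any.++⁺ˡ (∈-map⁺ (φ ∧_) χ∈) ,
    trans (val-∧ z φ χ) (cong₂ Bool._∧_ eq zχ) , λ y yχ →
      case ∧-true (trans (sym (val-∧ y φ χ)) yχ) of λ (p , q) → trans eq (sym p) ∷ agree y q
  ... | χ , χ∈ , zχ , agree | false =
    (∼ φ) ∧ χ , Any.++⁺ʳ (map (φ ∧_) (patterns g Φ)) (∈-map⁺ ((∼ φ) ∧_) χ∈) ,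
    trans (val-∧ z (∼ φ) χ) (cong₂ Bool._∧_ (trans (val-∼ z φ) (cong not eq)) zχ) , λ y yχ →
      case ∧-true (trans (sym (val-∧ y (∼ φ) χ)) yχ) of λ (p , q) →
        trans eq (not-injective (trans (sym p) (val-∼ y φ))) ∷ agree y q

  Determines : ℕ → List (ℒ m n) → Set₁
  Determines k Φ = ∀ u v → Agree Φ u v → ∀ g → depth g ≤ k → val u g ≡ val v g

  -- A pattern `χ` over the list for depth `k` describes a type of that depth completely, so
  -- `K j (∼ χ)` says whether agent `j` excludes this type. Points agreeing on these formulas admit
  -- the same types for each agent, and hence agree one depth further.
  determining : ℒ m n → ∀ k → ∃ (Determines k)
  determining f k = Φ k , determines k
    where
    know : ℕ → List (ℒ m n)
    Φ    : ℕ → List (ℒ m n)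
    know zero    = []
    know (suc k) = cartesianProductWith (λ j χ → K j (∼ χ)) (allFin n) (patterns f (Φ k))
    Φ k = map var (allFin m) ++ know k

    agree-K : ∀ k u v → Determines k (Φ k) → Agree (know (suc k)) u v →
              ∀ j g → depth g ≤ k → val u (K j g) ≡ true → val v (K j g) ≡ true
    agree-K k u v det agree j g d≤k eq = ¬-not λ eq′ →
      let z , v∼z , ¬g       = K-witness v j g eq′
          χ , χ∈ , zχ , sep  = pattern-of f (Φ k) z
          Kχ-v : val v (K j (∼ χ)) ≡ false
          Kχ-v = ¬-not λ eq″ → case trans (sym (cong not zχ)) (trans (sym (val-∼ z χ))
                   (K-reflexive z j (∼ χ) (trans (sym (v∼z (∼ χ))) eq″))) of λ ()
          Kχ-u : val u (K j (∼ χ)) ≡ false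
          Kχ-u = trans (All.lookup agree (∈-cartesianProductWith⁺ (λ j χ → K j (∼ χ)) (∈-allFin j) χ∈)) Kχ-v
          y , u∼y , ¬χ       = K-witness u j (∼ χ) Kχ-u
          yχ = not-injective (trans (sym (val-∼ y χ)) ¬χ)
      in case trans (sym (K-reflexive y j g (trans (sym (u∼y g)) eq)))
                    (trans (sym (det z y (sep y yχ) g d≤k)) ¬g) of λ ()

    determines : ∀ k → Determines k (Φ k)
    determines k u v agree (var i) _ = All.lookup agree (Any.++⁺ˡ (∈-map⁺ var (∈-allFin i)))
    determines k u v agree (∼ g) d≤k =
      trans (val-∼ u g) (trans (cong not (determines k u v agree g d≤k)) (sym (val-∼ v g)))
    determines k u v agree (g ∧ h) d≤k =
      trans (val-∧ u g h) (trans (cong₂ Bool._∧_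
        (determines k u v agree g (m⊔n≤o⇒m≤o _ _ d≤k)) (determines k u v agree h (m⊔n≤o⇒n≤o _ _ d≤k)))
        (sym (val-∧ v g h)))
    determines (suc k) u v agree (K j g) (s≤s d≤k) =
      true-ext (agree-K k u v (determines k) agree′ j g d≤k)
               (agree-K k v u (determines k) (All.map sym agree′) j g d≤k)
      where
      agree′ : Agree (know (suc k)) u v
      agree′ = All.++⁻ʳ (map var (allFin m)) agree

  representatives : ∀ {p} Φ (P : Pred (Ω m n) p) →
    ∃ λ us → All P us × (∀ u → P u → Any (Agree Φ u) us)
  representatives [] P with em {P = ∃ P}
  ... | yes (u , p) = u ∷ [] , p ∷ [] , λ _ _ → here []
  ... | no ¬∃       = [] , [] , λ u p → ⊥-elim (¬∃ (u , p))
  representatives (φ ∷ Φ) P = us ++ vs , All.++⁺ (All.map proj₁ us⊆P) (All.map proj₁ vs⊆P) , cover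
    where
    P⁺ = λ u → P u × val u φ ≡ true
    P⁻ = λ u → P u × val u φ ≡ false
    us = proj₁ (representatives Φ P⁺)
    us⊆P = proj₁ (proj₂ (representatives Φ P⁺))
    vs = proj₁ (representatives Φ P⁻)
    vs⊆P = proj₁ (proj₂ (representatives Φ P⁻))
    cover : ∀ u → P u → Any (Agree (φ ∷ Φ) u) (us ++ vs)
    cover u p with val u φ in eq
    ... | true  = Any.++⁺ˡ (extend us⊆P (proj₂ (proj₂ (representatives Φ P⁺)) u (p , eq)))
      where
      extend : ∀ {us} → All P⁺ us → Any (Agree Φ u) us → Any (λ v → All _ (φ ∷ Φ)) us
      extend (q ∷ _)  (here x)  = here (trans eq (sym (proj₂ q)) ∷ x)
      extend (_ ∷ qs) (there x) = there (extend qs x)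
    ... | false = Any.++⁺ʳ us (extend vs⊆P (proj₂ (proj₂ (representatives Φ P⁻)) u (p , eq)))
      where
      extend : ∀ {us} → All P⁻ us → Any (Agree Φ u) us → Any (λ v → All _ (φ ∷ Φ)) us
      extend (q ∷ _)  (here x)  = here (trans eq (sym (proj₂ q)) ∷ x)
      extend (_ ∷ qs) (there x) = there (extend qs x)

  finitely-many-types : ℒ m n → ∀ {p} k (P : Pred (Ω m n) p) →
    ∃ λ us → All P us × (∀ u → P u → Any (λ v → ∀ g → depth g ≤ k → val u g ≡ val v g) us)
  finitely-many-types f k P =
    let Φ , det           = determining f k
        us , us⊆P , cover = representatives Φ P
    in us , us⊆P , λ u p → Any.map (λ {v} → det u v) (cover u p)

  separate : (f : ℒ m n) (z : Ω m n) (ts : List (Ω m n)) → All (λ t → ¬ z ≋ t) ts →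
             ∃ λ g → val z g ≡ true × All (λ t → val t g ≡ false) ts
  separate f z [] [] = (f ⇒ f) , ⌊⌋-true (inΩ z (thm (⇒-refl f))) , []
  separate f z (t ∷ ts) (z≉t ∷ z≉ts)
    with g , zg , tsg ← separate f z ts z≉ts | h , z≢t ← ¬∀⇒∃¬ z≉t = pick (val z h) refl
    where
    pick : ∀ b → val z h ≡ b → ∃ λ g → val z g ≡ true × All (λ t → val t g ≡ false) (t ∷ ts)
    pick true eq = h ∧ g , trans (val-∧ z h g) (cong₂ Bool._∧_ eq zg) ,
      trans (val-∧ t h g) (cong (Bool._∧ val t g) (¬-not λ eq′ → z≢t (trans eq (sym eq′)))) ∷
      All.map (λ {t} eq → trans (val-∧ t h g) (trans (cong (val t h Bool.∧_) eq) (∧-zeroʳ (val t h)))) tsg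
    pick false eq = (∼ h) ∧ g ,
      trans (val-∧ z (∼ h) g) (cong₂ Bool._∧_ (trans (val-∼ z h) (cong not eq)) zg) ,
      trans (val-∧ t (∼ h) g) (cong (Bool._∧ val t g)
        (trans (val-∼ t h) (cong not (¬-not λ eq′ → z≢t (trans eq (sym eq′)))))) ∷
      All.map (λ {t} eq → trans (val-∧ t (∼ h) g)
        (trans (cong (val t (∼ h) Bool.∧_) eq) (∧-zeroʳ (val t (∼ h))))) tsg

-- Models whose theories form a cell

saturated-∼ : {D : Subset m n} → Saturated D → ∀ {x z} j → D x → x ∼[ j ] z → D z
saturated-∼ sat {x} j x∈D x∼z =
  sat j (λ z → Lift 1ℓ (x ∼[ j ] z)) (x , lower , lift) (x , lift (id , id) , x∈D) (lift x∼z)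

module Generation (em : ∀ {ℓ} → ExcludedMiddle ℓ) {m n : ℕ} (f : ℒ m (2+ n)) where
  open Classical em
  open Models em {m} {2+ n} public

  Agent : Set
  Agent = Fin (2+ n)

  val-⋀ : ∀ {k} (z : Ω m (2+ n)) (F : Fin (suc k) → ℒ m (2+ n)) →
          val z (⋀ F) ≡ true → ∀ i → val z (F i) ≡ true
  val-⋀ {zero}  z F eq zero    = eq
  val-⋀ {suc k} z F eq zero    = proj₁ (∧-true (trans (sym (val-∧ z (F zero) _)) eq))
  val-⋀ {suc k} z F eq (suc i) =
    val-⋀ z (F ∘ suc) (proj₂ (∧-true {val z (F zero)} (trans (sym (val-∧ z (F zero) _)) eq))) i

  module _ (N : Model) where
    open Model N

    sat-⋀ : ∀ {k} x (F : Fin (suc k) → ℒ m (2+ n)) →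
            (∀ i → sat x (F i) ≡ true) → sat x (⋀ F) ≡ true
    sat-⋀ {zero}  x F eq = eq zero
    sat-⋀ {suc k} x F eq = cong₂ Bool._∧_ (eq zero) (sat-⋀ x (F ∘ suc) (eq ∘ suc))

    sat-E^ : (∀ x → sat x f ≡ true) → ∀ i x → sat x (E^ i f) ≡ true
    sat-E^ all zero    x = all x
    sat-E^ all (suc i) x = sat-⋀ x (λ j → K j (E^ i f)) λ j → ⌊⌋-true λ y _ → sat-E^ all i y

    -- If no world of the class of `x` had theory `z`, one formula `g` would hold at `z` and fail at
    -- the finitely many theories of the class. Then `K j (∼ g)` would hold at `x`, hence at `z`,
    -- against `g`.
    th-R-closed : ∀ {x z} j (ts : List (Ω m (2+ n))) → (∀ y → R j x y → Any (th y ≋_) ts) →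
                  (∀ g → val (th x) (K j g) ≡ val z (K j g)) → ∃ λ y → R j x y × z ≋ th y
    th-R-closed {x} {z} j ts cover x∼z = dne λ ¬∃ →
      let ts′          = filter (λ t → em {P = ¬ z ≋ t}) ts
          g , zg , sep = separate f z ts′ (All.all-filter (λ t → em {P = ¬ z ≋ t}) ts)
          ¬g : ∀ y → R j x y → sat y (∼ g) ≡ true
          ¬g y r = let t , t∈ts , y≋t = find (cover y r)
                       t∈ts′ = ∈-filter⁺ (λ t → em {P = ¬ z ≋ t}) t∈ts
                                 λ z≋t → ¬∃ (y , r , λ h → trans (z≋t h) (sym (y≋t h)))
                   in cong not (trans (sym (val-th y g)) (trans (y≋t g) (All.lookup sep t∈ts′)))
          z-K : val z (K j (∼ g)) ≡ true
          z-K = trans (sym (x∼z (∼ g))) (trans (val-th x (K j (∼ g))) (⌊⌋-true ¬g))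
      in case trans (sym (K-reflexive z j (∼ g) z-K)) (trans (val-∼ z g) (cong not zg)) of λ ()

    Linked : Rel W 0ℓ
    Linked x y = ∃ λ j → R j x y

    Image : Subset m (2+ n)
    Image z = ∃ λ x → z ≋ th x

    module _ (fin : ∀ j x → ∃ λ ts → ∀ y → R j x y → Any (th y ≋_) ts) where

      image-saturated : Saturated Image
      image-saturated j P (x₀ , P⊆ , ⊆P) (z , z∈P , x , z≋x) {z′} z′∈P =
        let ts , cover = fin j x
            y , _ , eq = th-R-closed {x} {z′} j ts cover λ g →
              trans (sym (z≋x (K j g)))
                (trans (sym (∼ⱼ⇒val {z = x₀} {z} (P⊆ z∈P) g)) (∼ⱼ⇒val {z = x₀} {z′} (P⊆ z′∈P) g))
        in y , eq

      -- Linked worlds have theories in a common possibility set, so a saturated set containing one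
      -- theory contains those of all worlds reached by links; every world is reached through `x₀`.
      image-isCell : ∀ x₀ → (∀ x → Star Linked x₀ x) → IsCell Image
      image-isCell x₀ connected = record
        { nonEmpty  = th x₀ , x₀ , λ _ → refl
        ; saturated = image-saturated
        ; minimal   = minimal
        }
        where
        minimal : ∀ D → Satisfiable D → Saturated D → D ⊆ Image → Image ⊆ D
        minimal D (z₁ , z₁∈D) sat D⊆ {z} (x , z≋x) =
          respects (λ g → sym (z≋x g)) (along path (respects (proj₂ (D⊆ z₁∈D)) z₁∈D))
          where
          respects : ∀ {u v} → u ≋ v → D u → D v
          respects {u} {v} u≋v u∈D =
            saturated-∼ {D = D} sat zero u∈D (val⇒∼ⱼ {z = u} {v} λ g → u≋v (K zero g))
          path : Star Linked (proj₁ (D⊆ z₁∈D)) x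
          path = reverse (map₂ (λ {j} → ≡R.sym j)) (connected _) ◅◅ connected x
          along : ∀ {x y} → Star Linked x y → D (th x) → D (th y)
          along ε                   d = d
          along {x} (_◅_ {j = y} (j , r) p) d = along p
            (saturated-∼ {D = D} sat j d (val⇒∼ⱼ {z = th x} {th y} (th-R j r)))

      image-finiteFanout : FiniteFanout Image
      image-finiteFanout j P (x₀ , P⊆ , ⊆P) P⊆Image =
        zs , λ z → mk⇔ (to z) (from z)
        where
        inP : ∀ z → (∀ g → val x₀ (K j g) ≡ val z (K j g)) → P z
        inP z eq = ⊆P (val⇒∼ⱼ {z = x₀} {z} eq)
        outP : ∀ z → P z → ∀ g → val x₀ (K j g) ≡ val z (K j g)
        outP z p = ∼ⱼ⇒val {z = x₀} {z} (P⊆ p)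
        x = proj₁ (P⊆Image (inP x₀ λ _ → refl))
        x₀≋x = proj₂ (P⊆Image (inP x₀ λ _ → refl))
        ts = proj₁ (fin j x)
        P? = λ t → em {P = P t}
        -- The list `ts` covers the theories of the class of `x` but may contain points outside `P`.
        zs = filter P? ts
        to : ∀ z → P z → Any (z ≈_) zs
        to z p =
          let y , r , z≋y   = th-R-closed {x} {z} j ts (proj₂ (fin j x)) λ g →
                                trans (sym (x₀≋x (K j g))) (outP z p g)
              t , t∈ts , y≋t = find (proj₂ (fin j x) y r)
              z≋t : z ≋ t
              z≋t g = trans (z≋y g) (y≋t g)
          in lose (∈-filter⁺ P? t∈ts (inP t λ g → trans (outP z p g) (z≋t (K j g)))) (≋⇒≈ {z = z} {t} z≋t)
        from : ∀ z → Any (z ≈_) zs → P z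
        from z any =
          let t , t∈zs , z≈t = find any
              _ , t∈P        = ∈-filter⁻ P? {xs = ts} t∈zs
          in inP z λ g → trans (outP t t∈P g) (sym (≈⇒≋ {z = z} {t} z≈t (K j g)))

    image-dense : (∀ x → Ck f (th x)) →
                  (∀ z g → Ck f z → val z g ≡ true → ∃ λ x → sat x g ≡ true) →
                  Image DenseIn Ck f
    image-dense inCk hit =
      (λ {z} (x , z≋x) i → true-⌊⌋ (trans (z≋x (E^ i f)) (⌊⌋-true (inCk x i)))) ,
      λ U open-U (z , z∈U , z∈Ck) →
        let g , z∈g , g⊆U = open-U z z∈U
            x , eq        = hit z g z∈Ck (⌊⌋-true z∈g)
        in th x , g⊆U eq , x , λ _ → refl

  -- Points of `Ck f` and chains between them

  CK : Set₁
  CK = ∃ (Ck f)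

  val-E^ : ∀ ((u , _) : CK) i → val u (E^ i f) ≡ true
  val-E^ (u , u∈Ck) i = ⌊⌋-true (u∈Ck i)

  toCK : ∀ u → (∀ i → val u (E^ i f) ≡ true) → CK
  toCK u eq = u , λ i → true-⌊⌋ (eq i)

  thCK : (N : Model) → (∀ x → Model.sat N x f ≡ true) → Model.W N → CK
  thCK N all x = toCK (Model.th N x) λ i → trans (Model.val-th N x (E^ i f)) (sat-E^ N all i x)

  -- The conjunct `K j (E^ i f)` of `E^ (suc i) f` keeps the whole possibility set of `j` inside
  -- `Ck f`, so a counterexample is found there as well.
  CK-witness : ∀ ((u , _) : CK) j g → val u (K j g) ≡ false →
               ∃ λ ((v , _) : CK) → (∀ h → val u (K j h) ≡ val v (K j h)) × val v g ≡ false
  CK-witness c@(u , _) j g eq with v , u∼v , ¬g ← K-witness u j g eq =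
    toCK v (λ i → K-reflexive v j (E^ i f) (trans (sym (u∼v (E^ i f)))
             (val-⋀ u (λ j → K j (E^ i f)) (val-E^ c (suc i)) j))) ,
    u∼v , ¬g

  Chain : ℕ → Rel CK 0ℓ
  Chain k (u , _) (v , _) = ∃ λ j → u ∼⟨ k , j ⟩ v

  other : (j : Agent) → ∃ λ i → i ≢ j
  other zero    = suc zero , λ ()
  other (suc j) = zero , λ ()

  -- A new world r, labelled v, joins the j-class of u and the i-class of v
  -- for i ≢ j; this leaves formulas of depth at most k unchanged.
  module Bridge (k : ℕ) (j : Agent) (u v : CK) (d≤k : depth f ≤ k) (u∼v : proj₁ u ∼⟨ k , j ⟩ proj₁ v) where

    label : Maybe CK → Ω m (2+ n)
    label (just x) = proj₁ x
    label nothing  = proj₁ v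

    seat : Agent → Maybe CK → CK
    seat i (just x) = x
    seat i nothing with i ≟ j
    ... | yes _ = u
    ... | no _  = v

    N : Model
    N = record
      { W     = Maybe CK
      ; R     = λ i x y → ∀ g → val (proj₁ (seat i x)) (K i g) ≡ val (proj₁ (seat i y)) (K i g)
      ; equiv = λ i → record
        { refl  = λ _ → refl
        ; sym   = λ p g → sym (p g)
        ; trans = λ p q g → trans (p g) (q g)
        }
      ; V     = λ x i → val (label x) (var i)
      }

    open Model N

    label-seat : ∀ i x → label x ∼⟨ k , i ⟩ proj₁ (seat i x)
    label-seat i (just x) _ _ = refl
    label-seat i nothing  g d<k with i ≟ j
    ... | yes refl = sym (u∼v g d<k)
    ... | no _     = refl

    label-seat-≢ : ∀ i → i ≢ j → ∀ x → label x ≡ proj₁ (seat i x)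
    label-seat-≢ i i≢j (just x) = refl
    label-seat-≢ i i≢j nothing with i ≟ j
    ... | yes i≡j = ⊥-elim (i≢j i≡j)
    ... | no _    = refl

    witness : ∀ i x g → val (proj₁ (seat i x)) (K i g) ≡ false →
              ∃ λ y → R i x y × val (label y) g ≡ false
    witness i x g eq = let y , x∼y , ¬g = CK-witness (seat i x) i g eq in just y , x∼y , ¬g

    sat-label : ∀ g x → depth g ≤ k → sat x g ≡ val (label x) g
    sat-label = truth k label (λ _ _ → refl)
      (λ i {x} {y} r → ∼⟨⟩-trans {label x} {proj₁ (seat i x)} {label y} (label-seat i x)
        (∼⟨⟩-trans {proj₁ (seat i x)} {proj₁ (seat i y)} {label y} (λ g _ → r g)
          (∼⟨⟩-sym {label y} {proj₁ (seat i y)} (label-seat i y))))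
      (λ i x g d<k eq → witness i x g (trans (sym (label-seat i x g d<k)) eq))

    all-f : ∀ x → sat x f ≡ true
    all-f x = trans (sat-label f x d≤k) (in-f x)
      where
      in-f : ∀ x → val (label x) f ≡ true
      in-f (just x) = val-E^ x 0
      in-f nothing  = val-E^ v 0

    -- This is where a depth is gained. For an agent other than `j`, the label of a world and that
    -- of its seat coincide, so knowledge at the labels is transferred exactly; together with
    -- `sat-label` for `g` of depth `k` this settles `K i g`, of depth `suc k`.
    label-th : ∀ i → i ≢ j → ∀ x → label x ∼⟨ suc k , i ⟩ th x
    label-th i i≢j x g d<sk = trans (true-ext to from) (sym (val-th x (K i g)))
      where
      to : val (label x) (K i g) ≡ true → sat x (K i g) ≡ true
      to eq = ⌊⌋-true λ y r → trans (sat-label g y (≤-pred d<sk)) (K-reflexive (label y) i g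
        (trans (cong (λ z → val z (K i g)) (label-seat-≢ i i≢j y))
          (trans (sym (r g)) (trans (sym (cong (λ z → val z (K i g)) (label-seat-≢ i i≢j x))) eq))))
      from : sat x (K i g) ≡ true → val (label x) (K i g) ≡ true
      from eq = ¬-not λ eq′ →
        let y , r , ¬g = witness i x g (trans (sym (cong (λ z → val z (K i g)) (label-seat-≢ i i≢j x))) eq′)
        in case trans (sym (sat-K {x} i g r eq)) (trans (sat-label g y (≤-pred d<sk)) ¬g) of λ ()

    seat-j : seat j nothing ≡ u
    seat-j with j ≟ j
    ... | yes _  = refl
    ... | no j≢j = ⊥-elim (j≢j refl)

    -- One link becomes three: `label-th` relates `u` and `v` to the theories of `just u` and
    -- `nothing`, and these two worlds share a `j`-class, so the middle link holds at every depth.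
    chain : Star (Chain (suc k)) u v
    chain with i , i≢j ← other j =
      _◅_ {j = thCK N all-f (just u)} (i , label-th i i≢j (just u))
      (_◅_ {j = thCK N all-f nothing}
        (j , λ g _ → th-R {just u} {nothing} j (λ h → cong (λ c → val (proj₁ c) (K j h)) (sym seat-j)) g)
      ((i , λ g d<k → sym (label-th i i≢j nothing g d<k)) ◅ ε))

  extend : ∀ {i} (w : Ω≤ m (2+ n) i) → ∃ λ (z : Ω m (2+ n)) → ⟦ w ⟧ᵢ ⊆ ⟦ z ⟧
  extend w = lindenbaum (consistent⁻ (Ω≤.consistent w))

  -- Semantic closure is applied to the class `F` of `w` and to the set `B` of points with the same
  -- formulas as `y` of depth below that of the types. The point `y` itself shows that `F` meets
  -- `B`; closure moves the witness into `A`, and `B` keeps `g` false.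
  closed-witness : ∀ i (A : Pred (Ω≤ m (2+ n) i) 0ℓ) → Closed i A →
    ∀ j w → A w → ∀ g → depth g < i → ∀ y →
    (∀ h → depth h < i → ⟦ w ⟧ᵢ (K j h) → ⟦ y ⟧ (K j h)) →
    (∀ h → depth h < i → ⟦ y ⟧ (K j h) → ⟦ w ⟧ᵢ (K j h)) →
    val y g ≡ false →
    ∃ λ z → A (π i z) × (∀ h → depth h < i → ⟦ w ⟧ᵢ (K j h) → ⟦ z ⟧ (K j h)) ×
      (∀ h → depth h < i → ⟦ z ⟧ (K j h) → ⟦ w ⟧ᵢ (K j h)) × val z g ≡ false
  closed-witness (suc i) A closed j w w∈A g (s≤s d≤i) y w⇒y y⇒w ¬g =
    let z , w∼z , y≈z , z∈A = closed j B w F (π i y , lower , lift) w∈A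
          ((λ w′ → Lift 1ℓ (w ∼ᵢ[ j ] w′)) , (w , lower , lift) , (id , id))
          (λ w≈z → lift ((λ (d , x) → d , proj₁ w≈z x) , (λ (d , x) → d , proj₂ w≈z x)))
          (y , lift ((λ (d , x) → d , w⇒y _ (s≤s d) x , s≤s d) , λ (d , x , _) → d , y⇒w _ (s≤s d) x) ,
           lift (id , id))
    in z , z∈A ,
       (λ { h (s≤s d) x → proj₁ (proj₂ (proj₁ (lower w∼z) (d , x))) }) ,
       (λ { h (s≤s d) x → proj₂ (proj₂ (lower w∼z) (d , x , s≤s d)) }) ,
       ⌊⌋-false λ g∈z → false-⌊⌋ ¬g (proj₁ (proj₂ (lower y≈z) (g∈z , d≤i)))
    where
    B = λ z → Lift 1ℓ (π i y ≈ᵢ π i z)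
    F = λ z → Lift 1ℓ (w ∼ᵢ[ j ] π (suc i) z)

  -- An arbitrary extension of a type containing `f` need not lie in `Ck f`. Taking the members of
  -- `A` as worlds realises each of them by a theory all of whose accessible worlds again have types
  -- in `A`.
  module Lifting i (A : Pred (Ω≤ m (2+ n) i) 0ℓ) (closed : Closed i A) where

    ext : ∃ A → Ω m (2+ n)
    ext (w , _) = proj₁ (extend w)

    ext-∈ : ∀ x g → depth g ≤ i → ⟦ proj₁ x ⟧ᵢ g → val (ext x) g ≡ true
    ext-∈ (w , _) g d≤i g∈w = ⌊⌋-true (proj₂ (extend w) g∈w)

    ∈-ext : ∀ x g → depth g ≤ i → val (ext x) g ≡ true → ⟦ proj₁ x ⟧ᵢ g
    ∈-ext x@(w , _) g d≤i eq = Ω≤.maximal w (⟦ π i (ext x) ⟧ᵢ) proj₂ (Ω≤.consistent (π i (ext x)))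
      (λ h∈w → proj₂ (extend w) h∈w , Ω≤.bounded w h∈w) (true-⌊⌋ eq , d≤i)

    N : Model
    N = record
      { W     = ∃ A
      ; R     = λ j x y → ext x ∼⟨ i , j ⟩ ext y
      ; equiv = λ j → record
        { refl  = λ _ _ → refl
        ; sym   = λ p g d<i → sym (p g d<i)
        ; trans = λ p q g d<i → trans (p g d<i) (q g d<i)
        }
      ; V     = λ x k → val (ext x) (var k)
      }

    open Model N

    ext-π : ∀ z (z∈A : A (π i z)) g → depth g ≤ i → val (ext (π i z , z∈A)) g ≡ val z g
    ext-π z z∈A g d≤i = true-ext
      (λ eq → ⌊⌋-true (proj₁ (∈-ext (π i z , z∈A) g d≤i eq)))
      (λ eq → ext-∈ (π i z , z∈A) g d≤i (true-⌊⌋ eq , d≤i))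

    back : ∀ j x g → depth g < i → val (ext x) (K j g) ≡ false →
           ∃ λ y → R j x y × val (ext y) g ≡ false
    back j x@(w , w∈A) g d<i eq =
      let y , x∼y , ¬g = K-witness (ext x) j g eq
          z , z∈A , w⇒z , z⇒w , ¬g′ = closed-witness i A closed j w w∈A g d<i y
            (λ h d w∋ → true-⌊⌋ (trans (sym (x∼y h)) (ext-∈ x (K j h) d w∋)))
            (λ h d y∋ → ∈-ext x (K j h) d (trans (x∼y h) (⌊⌋-true y∋)))
            ¬g
      in (π i z , z∈A) ,
         (λ h d → trans (true-ext
            (λ eq → ⌊⌋-true (w⇒z h d (∈-ext x (K j h) d eq)))
            (λ eq → ext-∈ x (K j h) d (z⇒w h d (true-⌊⌋ eq))))
            (sym (ext-π z z∈A (K j h) d))) ,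
         trans (ext-π z z∈A g (<⇒≤ d<i)) ¬g′

    sat-ext : ∀ g x → depth g ≤ i → sat x g ≡ val (ext x) g
    sat-ext = truth i ext (λ _ _ → refl) (λ j r → r) back

  ∼ᵢ⇒∼⟨⟩ : ∀ i (w w′ : Ω≤ m (2+ n) i) j → w ∼ᵢ[ j ] w′ →
           ∀ h → depth h < i → ⟦ w ⟧ᵢ (K j h) → ⟦ w′ ⟧ᵢ (K j h)
  ∼ᵢ⇒∼⟨⟩ (suc i) w w′ j (p , _) h (s≤s d) x = proj₂ (p (d , x))

  ∼ᵢ-transˡ : ∀ i (x u v : Ω≤ m (2+ n) i) j → x ∼ᵢ[ j ] u → x ∼ᵢ[ j ] v → u ∼ᵢ[ j ] v
  ∼ᵢ-transˡ zero    x u v j _ _ = tt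
  ∼ᵢ-transˡ (suc i) x u v j (p , p′) (q , q′) = q ∘ p′ , p ∘ q′

  ∼ᵢ-sym : ∀ i (u v : Ω≤ m (2+ n) i) j → u ∼ᵢ[ j ] v → v ∼ᵢ[ j ] u
  ∼ᵢ-sym zero    u v j _       = tt
  ∼ᵢ-sym (suc i) u v j (p , q) = q , p

  module Base (closed : Closed (depth f) (α f)) (connected : Connected (α f)) where
    private
      d = depth f
    open Lifting d (α f) closed
    open Model N

    all-f : ∀ x → sat x f ≡ true
    all-f x = trans (sat-ext f x ≤-refl) (ext-∈ x f ≤-refl (proj₂ x))

    point : ∃ (α f) → CK
    point = thCK N all-f

    point-∈ : ∀ x g → depth g ≤ d → val (proj₁ (point x)) g ≡ val (ext x) g
    point-∈ x g d≤ = trans (val-th x g) (sat-ext g x d≤)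

    Step : Rel (Ω≤ m (2+ n) d) (lsuc 1ℓ)
    Step u v = α f u × α f v × (∃₂ λ j B → ℱ̄ d j B × B u × B v)

    chain-from : ∀ {w w′} (w∈ : α f w) (w′∈ : α f w′) → Star Step w w′ →
                 Star (Chain d) (point (w , w∈)) (point (w′ , w′∈))
    -- A world is a type with a proof of membership, so one type with two proofs gives two worlds,
    -- joined here by a link of agent `zero`.
    chain-from {w} w∈ w′∈ ε =
      (zero , λ g d< → trans (point-∈ (w , w∈) (K zero g) d<) (trans
        (true-ext (λ eq → ext-∈ (w , w′∈) (K zero g) d< (∈-ext (w , w∈) (K zero g) d< eq))
                  (λ eq → ext-∈ (w , w∈) (K zero g) d< (∈-ext (w , w′∈) (K zero g) d< eq)))
        (sym (point-∈ (w , w′∈) (K zero g) d<)))) ◅ ε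
    chain-from {w} w∈ w′∈ (_◅_ {j = v} (_ , v∈ , j , B , (x , B⊆ , _) , w∈B , v∈B) p) =
      (j , λ g d< → trans (point-∈ (w , w∈) (K j g) d<) (trans
        (true-ext (λ eq → ext-∈ (v , v∈) (K j g) d< (∼ᵢ⇒∼⟨⟩ d w v j w∼v g d< (∈-ext (w , w∈) (K j g) d< eq)))
                  (λ eq → ext-∈ (w , w∈) (K j g) d< (∼ᵢ⇒∼⟨⟩ d v w j (∼ᵢ-sym d w v j w∼v) g d<
                     (∈-ext (v , v∈) (K j g) d< eq))))
        (sym (point-∈ (v , v∈) (K j g) d<)))) ◅ chain-from v∈ w′∈ p
      where
      w∼v : w ∼ᵢ[ j ] v
      w∼v = ∼ᵢ-transˡ d x w v j (B⊆ w∈B) (B⊆ v∈B)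

    type : CK → ∃ (α f)
    type (u , u∈) = π d u , u∈ 0 , ≤-refl

    point-type : ∀ u g → depth g ≤ d → val (proj₁ u) g ≡ val (proj₁ (point (type u))) g
    point-type u g d≤ = sym (trans (point-∈ (type u) g d≤) (ext-π (proj₁ u) (proj₂ (type u)) g d≤))

    chain-base : ∀ u v → Star (Chain d) u v
    chain-base u v =
      (zero , λ g → point-type u (K zero g)) ◅
      chain-from (proj₂ (type u)) (proj₂ (type v))
        (connected (proj₁ (type u)) (proj₁ (type v)) (proj₂ (type u)) (proj₂ (type v))) ◅◅
      (zero , λ g d< → sym (point-type v (K zero g) d<)) ◅ ε

    chain : ∀ k → d ≤′ k → ∀ u v → Star (Chain k) u v
    chain k       ≤′-refl       u v = chain-base u v
    chain (suc k) (≤′-step d≤k) u v = kleisliStar id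
      (λ {x} {y} (j , x∼y) → Bridge.chain k j x y (≤′⇒≤ d≤k) x∼y) (chain k d≤k u v)

-- The block models along a branch

module Construction (em : ∀ {ℓ} → ExcludedMiddle ℓ) {m n : ℕ} (f : ℒ m (2+ n))
  (chain : ∀ k → depth f ≤ k → (u v : Generation.CK em f) → Star (Generation.Chain em f k) u v)
  (infinite : (ts : List (Ω m (2+ n))) →
              ∃ λ (u : Generation.CK em f) → All (λ t → ¬ Classical._≋_ em (proj₁ u) t) ts)
  where
  open Classical em
  open Generation em f

  z₀ : CK
  z₀ = proj₁ (infinite [])

  agent : ℕ → Agent
  agent zero          = zero
  agent (suc zero)    = suc zero
  agent (suc (suc i)) = agent i

  agent-alternates : ∀ i → agent (suc i) ≢ agent i
  agent-alternates zero          = λ ()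
  agent-alternates (suc zero)    = λ ()
  agent-alternates (suc (suc i)) = agent-alternates i

  record Entry : Set₁ where
    constructor entry
    field
      level : ℕ
      gate  : CK
  open Entry

  Point : Set₁
  Point = ℕ × CK

  root : Point
  root = 0 , z₀

  -- Block i is a copy of Ck f in which agent j only perceives formulas
  -- K j g with g of depth below the level of D i. If c i holds, the classes
  -- of agent i at the gates of the blocks i and i + 1 are merged; home
  -- moves the latter class to the former.
  module Blocks (D : ℕ → Entry) (c : ℕ → Bool) where

    Moves : Agent → ℕ → CK → Bool → Entry → Set
    Moves j i u b e = b ≡ true × j ≡ agent i × proj₁ u ∼⟨ level e , j ⟩ proj₁ (gate e)

    homeAt : ∀ j i u b → Entry → Entry → Point
    homeAt j i u b e e′ = if ⌊ Moves j i u b e′ ⌋ then (i , gate e) else (suc i , u)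

    home : Agent → Point → Point
    home j (zero  , u) = zero , u
    home j (suc i , u) = homeAt j i u (c i) (D i) (D (suc i))

    data HomeView (j : Agent) : Point → Set₁ where
      stays : ∀ {x} → home j x ≡ x → HomeView j x
      moves : ∀ i u → Moves j i u (c i) (D (suc i)) → home j (suc i , u) ≡ (i , gate (D i)) →
              HomeView j (suc i , u)

    home-moves : ∀ j i u → Moves j i u (c i) (D (suc i)) → home j (suc i , u) ≡ (i , gate (D i))
    home-moves j i u mv = cong (if_then (i , gate (D i)) else (suc i , u)) (⌊⌋-true mv)

    home-stays : ∀ j i u → ¬ Moves j i u (c i) (D (suc i)) → home j (suc i , u) ≡ (suc i , u)
    home-stays j i u ¬mv = cong (if_then (i , gate (D i)) else (suc i , u)) (⌊⌋-false ¬mv)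

    homeView : ∀ j x → HomeView j x
    homeView j (zero  , u) = stays refl
    homeView j (suc i , u) with em {P = Moves j i u (c i) (D (suc i))}
    ... | yes mv = moves i u mv (home-moves j i u mv)
    ... | no ¬mv = stays (home-stays j i u ¬mv)

    -- Only agent `i` moves a class from block `suc i` to block `i`. A further move down would need
    -- the agent of the preceding link, which is a different one by alternation.
    home-idempotent : ∀ j x → home j (home j x) ≡ home j x
    home-idempotent j x with homeView j x
    ... | stays eq = cong (home j) eq
    ... | moves i u (_ , j≡ , _) eq = trans (cong (home j) eq) (trans (gate-stays i j≡) (sym eq))
      where
      gate-stays : ∀ i → j ≡ agent i → home j (i , gate (D i)) ≡ (i , gate (D i))
      gate-stays zero    _  = refl
      gate-stays (suc i) j≡ = home-stays j i _ λ (_ , j≡′ , _) →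
        agent-alternates i (trans (sym j≡) j≡′)

    Same : Agent → Rel Point 0ℓ
    Same j (i , u) (i′ , v) = i ≡ i′ × proj₁ u ∼⟨ level (D i) , j ⟩ proj₁ v

    same-refl : ∀ j x → Same j x x
    same-refl j x = refl , λ _ _ → refl

    same-sym : ∀ j {x y} → Same j x y → Same j y x
    same-sym j (refl , p) = refl , λ g d → sym (p g d)

    same-trans : ∀ j {x y z} → Same j x y → Same j y z → Same j x z
    same-trans j (refl , p) (refl , q) = refl , λ g d → trans (p g d) (q g d)

    N : Model
    N = record
      { W     = Point
      ; R     = λ j x y → Same j (home j x) (home j y)
      ; equiv = λ j → record
        { refl  = λ {x} → same-refl j (home j x)
        ; sym   = λ {x} {y} → same-sym j {home j x} {home j y}
        ; trans = λ {x} {y} {z} → same-trans j {home j x} {home j y} {home j z}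
        }
      ; V     = λ (_ , u) k → val (proj₁ u) (var k)
      }

    open Model N public

    R-home : ∀ j x → R j x (home j x)
    R-home j x = subst (Same j (home j x)) (sym (home-idempotent j x)) (same-refl j (home j x))

    R-block : ∀ j i u v → proj₁ u ∼⟨ level (D i) , j ⟩ proj₁ v → R j (i , u) (i , v)
    R-block j zero    u v u∼v = refl , u∼v
    R-block j (suc i) u v u∼v with em {P = Moves j i u (c i) (D (suc i))}
    ... | yes mv@(ci , j≡ , u∼) = subst₂ (Same j) (sym (home-moves j i u mv))
            (sym (home-moves j i v (ci , j≡ , λ g d → trans (sym (u∼v g d)) (u∼ g d))))
            (same-refl j (i , gate (D i)))
    ... | no ¬mv = subst₂ (Same j) (sym (home-stays j i u ¬mv))
            (sym (home-stays j i v λ (ci , j≡ , v∼) → ¬mv (ci , j≡ , λ g d → trans (u∼v g d) (v∼ g d))))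
            (refl , u∼v)

    R-link : ∀ i → c i ≡ true → R (agent i) (i , gate (D i)) (suc i , gate (D (suc i)))
    R-link i ci = ≡R.sym (agent i) {suc i , gate (D (suc i))} {i , gate (D i)}
      (subst (R (agent i) (suc i , gate (D (suc i))))
        (home-moves (agent i) i _ (ci , refl , λ _ _ → refl))
        (R-home (agent i) (suc i , gate (D (suc i)))))

    home-≤ : ∀ j x → proj₁ (home j x) ≤ proj₁ x
    home-≤ j x with homeView j x
    ... | stays eq       = ≤-reflexive (cong proj₁ eq)
    ... | moves i u _ eq = ≤-trans (≤-reflexive (cong proj₁ eq)) (n≤1+n i)

    ≤-home : ∀ j x → proj₁ x ≤ suc (proj₁ (home j x))
    ≤-home j x with homeView j x
    ... | stays eq       = ≤-trans (≤-reflexive (sym (cong proj₁ eq))) (n≤1+n _)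
    ... | moves i u _ eq = s≤s (≤-reflexive (sym (cong proj₁ eq)))

    R-≤ : ∀ j x y → R j x y → proj₁ y ≤ suc (proj₁ x)
    R-≤ j x y (eq , _) = ≤-trans (≤-home j y) (s≤s (≤-trans (≤-reflexive (sym eq)) (home-≤ j x)))

    R-closed : ∀ k → (∀ i → c i ≡ true → i < k) → ∀ j x y → R j x y → proj₁ x ≤ k → proj₁ y ≤ k
    R-closed k off j x y (eq , _) x≤k with homeView j y
    ... | stays eq′            = ≤-trans (≤-reflexive (trans (sym (cong proj₁ eq′)) (sym eq)))
                                         (≤-trans (home-≤ j x) x≤k)
    ... | moves i u (ci , _) _ = off i ci

    -- The depth of `g` is unrestricted: points with the same type up to the level of the block
    -- share a class for every agent, and `K j g` is constant on classes. Hence a block has only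
    -- finitely many theories.
    sat-type : ∀ i u v → (∀ g → depth g ≤ level (D i) → val (proj₁ u) g ≡ val (proj₁ v) g) →
               ∀ g → sat (i , u) g ≡ sat (i , v) g
    sat-type i u v eq (var k) = eq (var k) z≤n
    sat-type i u v eq (∼ g)   = cong not (sat-type i u v eq g)
    sat-type i u v eq (g ∧ h) = cong₂ Bool._∧_ (sat-type i u v eq g) (sat-type i u v eq h)
    sat-type i u v eq (K j g) = sat-K-cong {i , u} {i , v} j g (R-block j i u v λ g d → eq (K j g) d)

    block-theories : ∀ i → ∃ λ ts → ∀ u → Any (th (i , u) ≋_) ts
    block-theories i =
      let us , us⊆Ck , cover = finitely-many-types f (level (D i)) (Ck f)
      in All.reduce (λ {u} p → th (i , u , p)) us⊆Ck , λ (u , u∈Ck) → transfer (u , u∈Ck) us⊆Ck (cover u u∈Ck)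
      where
      transfer : ∀ (u : CK) {us} (us⊆Ck : All (Ck f) us) →
        Any (λ v → ∀ g → depth g ≤ level (D i) → val (proj₁ u) g ≡ val v g) us →
        Any (th (i , u) ≋_) (All.reduce (λ {u} p → th (i , u , p)) us⊆Ck)
      transfer u (p ∷ ps) (here eq)   = here λ g →
        trans (val-th (i , u) g) (trans (sat-type i u (_ , p) eq g) (sym (val-th (i , _ , p) g)))
      transfer u (p ∷ ps) (there any) = there (transfer u ps any)

    theories : ∀ k → ∃ λ ts → ∀ x → proj₁ x ≤ k → Any (th x ≋_) ts
    theories zero    = proj₁ (block-theories 0) , λ where
      (zero , u) z≤n → proj₂ (block-theories 0) u
    theories (suc k) = proj₁ (theories k) ++ proj₁ (block-theories (suc k)) , cover
      where
      cover : ∀ x → proj₁ x ≤ suc k → Any (th x ≋_) _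
      cover (i , u) i≤ with m≤n⇒m<n∨m≡n i≤
      ... | inj₁ (s≤s i≤k) = Any.++⁺ˡ (proj₂ (theories k) (i , u) i≤k)
      ... | inj₂ refl      = Any.++⁺ʳ (proj₁ (theories k)) (proj₂ (block-theories (suc k)) u)

    fanout : ∀ j x → ∃ λ ts → ∀ y → R j x y → Any (th y ≋_) ts
    fanout j x = let ts , cover = theories (suc (proj₁ x)) in ts , λ y r → cover y (R-≤ j x y r)

    -- Finitely many blocks realise finitely many theories, whereas `Ck f` is infinite.
    novelty : ∀ k → ∃ λ h → (∃ λ (u : CK) → val (proj₁ u) h ≡ true) × (∀ x → proj₁ x ≤ k → sat x h ≡ false)
    novelty k =
      let ts , cover   = theories k
          u , u∉ts     = infinite ts
          h , uh , tsh = separate f (proj₁ u) ts u∉ts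
      in h , (u , uh) , λ x x≤k →
           let t , t∈ts , x≋t = find (cover x x≤k)
           in trans (sym (val-th x h)) (trans (x≋t h) (All.lookup tsh t∈ts))

    module _ (deep : ∀ i → depth f ≤ level (D i)) where

      block-connected : ∀ i u v → Star (Linked N) (i , u) (i , v)
      block-connected i u v = gmap (i ,_) (λ {u} {v} (j , u∼v) → j , R-block j i u v u∼v)
        (chain (level (D i)) (deep i) u v)

      connected : ∀ i u → (∀ i′ → i′ < i → c i′ ≡ true) → Star (Linked N) root (i , u)
      connected zero    u on = block-connected 0 z₀ u
      connected (suc i) u on =
        connected i (gate (D i)) (λ i′ i′<i → on i′ (m≤n⇒m≤1+n i′<i)) ◅◅
        (agent i , R-link i (on i ≤-refl)) ◅ block-connected (suc i) (gate (D (suc i))) u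

  module Locality (D D′ : ℕ → Entry) (c c′ : ℕ → Bool) (k : ℕ)
    (D≡D′ : ∀ i → i ≤ k → D i ≡ D′ i) (c≡c′ : ∀ i → i < k → c i ≡ c′ i) where
    module B  = Blocks D c
    module B′ = Blocks D′ c′

    home-local : ∀ j x → proj₁ x ≤ k → B.home j x ≡ B′.home j x
    home-local j (zero  , u) _   = refl
    home-local j (suc i , u) i<k
      rewrite D≡D′ i (<⇒≤ i<k) | D≡D′ (suc i) i<k | c≡c′ i i<k = refl

    R-local : ∀ j x y → proj₁ x ≤ k → proj₁ y ≤ k → B.R j x y → B′.R j x y
    R-local j x y x≤k y≤k (eq , p) rewrite sym (home-local j x x≤k) | sym (home-local j y y≤k) =
      eq , subst (λ e → proj₁ (proj₂ (B.home j x)) ∼⟨ level e , j ⟩ proj₁ (proj₂ (B.home j y)))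
             (D≡D′ _ (≤-trans (B.home-≤ j x) x≤k)) p

  -- By `R-≤` each knowledge operator leads at most one block up, so evaluating `g` at `x` involves
  -- only blocks up to `proj₁ x + depth g`.
  sat-local : ∀ (D D′ : ℕ → Entry) (c c′ : ℕ → Bool) (k : ℕ) →
    (∀ i → i ≤ k → D i ≡ D′ i) → (∀ i → i < k → c i ≡ c′ i) →
    ∀ g x → proj₁ x + depth g ≤ k → Blocks.sat D c x g ≡ Blocks.sat D′ c′ x g
  sat-local D D′ c c′ k D≡D′ c≡c′ = go
    where
    module L  = Locality D D′ c c′ k D≡D′ c≡c′
    module L′ = Locality D′ D c′ c k (λ i i≤k → sym (D≡D′ i i≤k)) (λ i i<k → sym (c≡c′ i i<k))
    go : ∀ g x → proj₁ x + depth g ≤ k → L.B.sat x g ≡ L.B′.sat x g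
    go (var _) x _ = refl
    go (∼ g)   x d = cong not (go g x d)
    go (g ∧ h) x d = cong₂ Bool._∧_
      (go g x (≤-trans (+-monoʳ-≤ (proj₁ x) (m≤m⊔n _ _)) d))
      (go h x (≤-trans (+-monoʳ-≤ (proj₁ x) (m≤n⊔m _ _)) d))
    go (K j g) x d = ⌊⌋-cong
      (λ s y r → let y≤ = L.B′.R-≤ j x y r in
        trans (sym (go g y (near y≤))) (s y (L′.R-local j x y here′ (there′ y≤) r)))
      (λ s y r → let y≤ = L.B.R-≤ j x y r in
        trans (go g y (near y≤)) (s y (L.R-local j x y here′ (there′ y≤) r)))
      where
      d′ : suc (proj₁ x) + depth g ≤ k
      d′ = ≤-trans (≤-reflexive (sym (+-suc (proj₁ x) (depth g)))) d
      near : ∀ {i} → i ≤ suc (proj₁ x) → i + depth g ≤ k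
      near i≤ = ≤-trans (+-monoˡ-≤ (depth g) i≤) d′
      here′ : proj₁ x ≤ k
      here′ = ≤-trans (m≤m+n _ _) d
      there′ : ∀ {i} → i ≤ suc (proj₁ x) → i ≤ k
      there′ i≤ = ≤-trans (m≤m+n _ _) (near i≤)

  upTo : ℕ → ℕ → Bool
  upTo k i = ⌊ i < k ⌋

  update : (ℕ → Entry) → ℕ → Entry → ℕ → Entry
  update D k e i with i ≤? k
  ... | yes _ = D i
  ... | no _  = e

  update-≤ : ∀ D k e i → i ≤ k → D i ≡ update D k e i
  update-≤ D k e i i≤k with i ≤? k
  ... | yes _  = refl
  ... | no i≰k = ⊥-elim (i≰k i≤k)

  update-> : ∀ D k e i → ¬ i ≤ k → update D k e i ≡ e
  update-> D k e i i≰k with i ≤? k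
  ... | yes i≤k = ⊥-elim (i≰k i≤k)
  ... | no _    = refl

  upTo-suc : ∀ k i → i < k → upTo k i ≡ upTo (suc k) i
  upTo-suc k i i<k = trans (⌊⌋-true i<k) (sym (⌊⌋-true (m≤n⇒m≤1+n i<k)))

  -- With the theory of the old gate as new gate, the two classes merged agree on every `K j g` with
  -- `depth g < κ`. Old worlds are labelled by their theories, since earlier merges may have changed
  -- them from the points they started as. Entries beyond `suc k` are unlinked placeholders that the
  -- next step overwrites.
  module Append (D : ℕ → Entry) (k : ℕ) (good : ∀ x → Blocks.sat D (upTo k) x f ≡ true) (κ : ℕ) where
    module O = Blocks D (upTo k)

    gate′ : CK
    gate′ = thCK O.N good (k , gate (D k))

    D′ : ℕ → Entry
    D′ = update D k (entry κ gate′)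

    module A = Blocks D′ (upTo (suc k))
    module L  = Locality D D′ (upTo k) (upTo (suc k)) k (update-≤ D k _) (upTo-suc k)

    label : Point → Ω m (2+ n)
    label (i , u) with i ≤? k
    ... | yes _ = O.th (i , u)
    ... | no _  = proj₁ u

    label-≤ : ∀ x → proj₁ x ≤ k → label x ≡ O.th x
    label-≤ (i , u) i≤k with i ≤? k
    ... | yes _  = refl
    ... | no i≰k = ⊥-elim (i≰k i≤k)

    label-> : ∀ x → ¬ proj₁ x ≤ k → label x ≡ proj₁ (proj₂ x)
    label-> (i , u) i≰k with i ≤? k
    ... | yes i≤k = ⊥-elim (i≰k i≤k)
    ... | no _    = refl

    ∼-subst : ∀ {u u′ v v′ : Ω m (2+ n)} {j} → u ≡ u′ → v ≡ v′ → u′ ∼⟨ κ , j ⟩ v′ → u ∼⟨ κ , j ⟩ v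
    ∼-subst refl refl p = p

    label-home : ∀ j x → label x ∼⟨ κ , j ⟩ label (A.home j x)
    label-home j x with em {P = proj₁ x ≤ k}
    ... | yes x≤k = ∼-subst (label-≤ x x≤k)
            (trans (cong label (sym (L.home-local j x x≤k))) (label-≤ _ (≤-trans (O.home-≤ j x) x≤k)))
            (λ g _ → O.th-R {x} {O.home j x} j (O.R-home j x) g)
    ... | no x≰k with A.homeView j x
    ...   | A.stays eq = ∼-subst {label x} {label x} {label (A.home j x)} {label x}
            refl (cong label eq) (λ _ _ → refl)
    -- An active link has index at most `k` and `x` lies beyond block `k`, so the link crossed is
    -- the new one.
    ...   | A.moves i u (on , _ , u∼) eq with refl ← ≤-antisym (≤-pred (≰⇒> x≰k)) (≤-pred (true-⌊⌋ on)) =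
            ∼-subst (label-> (suc k , u) x≰k)
              (trans (cong label eq) (trans (label-≤ (k , gate (D′ k)) ≤-refl)
                (cong (λ e → O.th (k , gate e)) (sym (update-≤ D k _ k ≤-refl)))))
              (subst (λ e → proj₁ u ∼⟨ level e , j ⟩ proj₁ (gate e)) (update-> D k _ (suc k) x≰k) u∼)

    label-same : ∀ j x y → A.Same j x y → label x ∼⟨ κ , j ⟩ label y
    label-same j x@(i , u) y@(_ , v) (refl , u∼v) with em {P = i ≤ k}
    ... | yes i≤k = ∼-subst (label-≤ x i≤k) (label-≤ y i≤k) λ g _ → O.th-R {x} {y} j
            (O.R-block j i u v (subst (λ e → proj₁ u ∼⟨ level e , j ⟩ proj₁ v) (sym (update-≤ D k _ i i≤k)) u∼v)) g
    ... | no i≰k  = ∼-subst (label-> x i≰k) (label-> y i≰k)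
            (subst (λ e → proj₁ u ∼⟨ level e , j ⟩ proj₁ v) (update-> D k _ i i≰k) u∼v)

    forth : ∀ j {x y} → A.R j x y → label x ∼⟨ κ , j ⟩ label y
    forth j {x} {y} r g d = trans (label-home j x g d)
      (trans (label-same j (A.home j x) (A.home j y) r g d) (sym (label-home j y g d)))

    witness : ∀ j x g → val (label x) (K j g) ≡ false →
              ∃ λ y → A.R j x y × val (label y) g ≡ false
    witness j x@(i , u) g eq with em {P = proj₁ x ≤ k}
    ... | yes x≤k =
      let y , r , ¬g = O.sat-¬K {x} j g (trans (sym (O.val-th x (K j g)))
                         (trans (cong (λ z → val z (K j g)) (sym (label-≤ x x≤k))) eq))
          y≤k        = O.R-closed k (λ i → true-⌊⌋) j x y r x≤k
      in y , L.R-local j x y x≤k y≤k r ,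
         trans (cong (λ z → val z g) (label-≤ y y≤k)) (trans (O.val-th y g) ¬g)
    ... | no x≰k =
      let v , u∼v , ¬g = CK-witness u j g (trans (cong (λ z → val z (K j g)) (sym (label-> x x≰k))) eq)
      in (i , v) , A.R-block j i u v (λ g _ → u∼v g) ,
         trans (cong (λ z → val z g) (label-> (i , v) x≰k)) ¬g

    back : ∀ j x g → depth g < κ → val (label x) (K j g) ≡ false →
           ∃ λ y → A.R j x y × val (label y) g ≡ false
    back j x g d eq =
      let y , r , ¬g = witness j (A.home j x) g (trans (sym (label-home j x g d)) eq)
      in y , A.≡R.trans j {x} {A.home j x} {y} (A.R-home j x) r , ¬g

    vars : ∀ x i → val (proj₁ (proj₂ x)) (var i) ≡ val (label x) (var i)
    vars (i , u) j with i ≤? k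
    ... | yes _ = sym (O.val-th (i , u) (var j))
    ... | no _  = refl

    sat-label : ∀ g x → depth g ≤ κ → A.sat x g ≡ val (label x) g
    sat-label = A.truth κ label vars (λ j {x} {y} → forth j {x} {y}) back

    sat-old : ∀ g x → proj₁ x ≤ k → depth g ≤ κ → A.sat x g ≡ O.sat x g
    sat-old g x x≤k d = trans (sat-label g x d)
      (trans (cong (λ z → val z g) (label-≤ x x≤k)) (O.val-th x g))

    sat-new : ∀ g x → ¬ proj₁ x ≤ k → depth g ≤ κ → A.sat x g ≡ val (proj₁ (proj₂ x)) g
    sat-new g x x≰k d = trans (sat-label g x d) (cong (λ z → val z g) (label-> x x≰k))

    good′ : depth f ≤ κ → ∀ x → A.sat x f ≡ true
    good′ d x with em {P = proj₁ x ≤ k}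
    ... | yes x≤k = trans (sat-old f x x≤k d) (good x)
    ... | no x≰k  = trans (sat-new f x x≰k d) (val-E^ (proj₂ x) 0)

    deep′ : (∀ i → depth f ≤ level (D i)) → depth f ≤ κ → ∀ i → depth f ≤ level (D′ i)
    deep′ deep d i with i ≤? k
    ... | yes _ = deep i
    ... | no _  = d

  record State (k : ℕ) : Set₁ where
    field
      D     : ℕ → Entry
      bound : ℕ
      good  : ∀ x → Blocks.sat D (upTo k) x f ≡ true
      deep  : ∀ i → depth f ≤ level (D i)
      wide  : depth f ≤ bound
  open State

  satₛ : ∀ {k} → State k → Point → ℒ m (2+ n) → Bool
  satₛ {k} S = Blocks.sat (D S) (upTo k)

  -- The two ways to append a block: in the second its level is so large
  -- that it contains a world satisfying a formula which is false everywhere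
  -- in the first.
  module Step {k} (S : State k) where

    module A₀ = Append (D S) k (good S) (bound S)

    opaque
      novel : ∃ λ h → (∃ λ (u : CK) → val (proj₁ u) h ≡ true) ×
              (∀ x → proj₁ x ≤ suc k → A₀.A.sat x h ≡ false)
      novel = A₀.A.novelty (suc k)

    h : ℒ m (2+ n)
    h = proj₁ novel

    κ : Bool → ℕ
    κ false = bound S
    κ true  = bound S ⊔ depth h

    bound≤κ : ∀ b → bound S ≤ κ b
    bound≤κ false = ≤-refl
    bound≤κ true  = m≤m⊔n _ _

    module Ap b = Append (D S) k (good S) (κ b)

    -- If the roots had equal theories, every link of the second model could be followed in the
    -- first, whose classes have finitely many theories. All theories of the second reached from the
    -- root would then occur in the first, among them one containing `h`.
    roots-differ : ¬ (Ap.A.th false root ≋ Ap.A.th true root)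
    roots-differ eq =
      let y , y≤k , x≋y = along
            (Ap.A.connected true (Ap.deep′ true (deep S) (≤-trans (wide S) (bound≤κ true)))
              (suc k) v λ i i< → ⌊⌋-true i<)
            (root , z≤n , λ g → sym (eq g))
      in case trans (sym (trans (Ap.sat-new true h (suc k , v) 1+n≰n (m≤n⊔m _ _)) vh))
           (trans (sym (Ap.A.val-th true (suc k , v) h)) (trans (x≋y h)
             (trans (Ap.A.val-th false y h) (proj₂ (proj₂ novel) y y≤k)))) of λ ()
      where
      v  = proj₁ (proj₁ (proj₂ novel))
      vh = proj₂ (proj₁ (proj₂ novel))
      Copied : Point → Set₁
      Copied x = ∃ λ y → proj₁ y ≤ suc k × Ap.A.th true x ≋ Ap.A.th false y
      along : ∀ {x x′} → Star (Linked (Ap.A.N true)) x x′ → Copied x → Copied x′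
      along ε c = c
      along {x} (_◅_ {j = x′} (j , r) p) (y , y≤k , x≋y) =
        let closed         = λ y′ r′ → Ap.A.R-closed false (suc k) (λ i → true-⌊⌋) j y y′ r′ y≤k
            ts , cover     = Ap.A.theories false (suc k)
            y′ , r′ , x≋y′ = th-R-closed (Ap.A.N false) {y} {Ap.A.th true x′} j ts
              (λ y′ r′ → cover y′ (closed y′ r′))
              λ g → trans (sym (x≋y (K j g))) (Ap.A.th-R true {x} {x′} j r g)
        in along p (y′ , closed y′ r′ , x≋y′)

    opaque
      difference : ∃ λ g → ¬ (Ap.A.sat false root g ≡ Ap.A.sat true root g)
      difference = map₂
        (λ {g} neq eq → neq (trans (Ap.A.val-th false root g) (trans eq (sym (Ap.A.val-th true root g)))))
        (¬∀⇒∃¬ roots-differ)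

    next : Bool → State (suc k)
    next b = record
      { D     = Ap.D′ b
      -- The bound is the same for both choices and covers `difference`, so later steps cannot blur
      -- which choice was made. The successor makes bounds exceed every depth eventually, as density
      -- requires.
      ; bound = suc (κ true ⊔ depth (proj₁ difference))
      ; good  = Ap.good′ b (≤-trans (wide S) (bound≤κ b))
      ; deep  = Ap.deep′ b (deep S) (≤-trans (wide S) (bound≤κ b))
      ; wide  = ≤-trans (wide S) (≤-trans (m≤m⊔n _ _) (≤-trans (m≤m⊔n _ _) (n≤1+n _)))
      }

    bound-grows : ∀ b → suc (bound S) ≤ bound (next b)
    bound-grows b = s≤s (≤-trans (m≤m⊔n _ _) (m≤m⊔n _ _))

    difference≤bound : depth (proj₁ difference) ≤ suc (κ true ⊔ depth (proj₁ difference))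
    difference≤bound = ≤-trans (m≤n⊔m (κ true) _) (n≤1+n _)

    next-separates : ∀ b b′ →
      (∀ g → depth g ≤ bound (next b) → satₛ (next b) root g ≡ satₛ (next b′) root g) → b ≡ b′
    next-separates false false _ = refl
    next-separates true  true  _ = refl
    next-separates false true  same = ⊥-elim (proj₂ difference (same (proj₁ difference) difference≤bound))
    next-separates true  false same = ⊥-elim (proj₂ difference (sym (same (proj₁ difference) difference≤bound)))

  start : State 0
  start = record
    { D     = D₀
    ; bound = depth f
    ; good  = λ x → trans (B.truth (depth f) (λ x → proj₁ (proj₂ x)) (λ _ _ → refl)
                (λ j {x} {y} → forth j x y) back f x ≤-refl) (val-E^ (proj₂ x) 0)
    ; deep  = λ _ → ≤-refl
    ; wide  = ≤-refl
    }
    where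
    D₀ : ℕ → Entry
    D₀ _ = entry (depth f) z₀
    module B = Blocks D₀ (upTo 0)
    home≡ : ∀ j x → B.home j x ≡ x
    home≡ j x with B.homeView j x
    ... | B.stays eq = eq
    ... | B.moves i u (on , _) _ with () ← true-⌊⌋ on
    forth : ∀ j x y → B.R j x y → proj₁ (proj₂ x) ∼⟨ depth f , j ⟩ proj₁ (proj₂ y)
    forth j x y r = proj₂ (subst₂ (B.Same j) (home≡ j x) (home≡ j y) r)
    back : ∀ j x g → depth g < depth f → val (proj₁ (proj₂ x)) (K j g) ≡ false →
           ∃ λ y → B.R j x y × val (proj₁ (proj₂ y)) g ≡ false
    back j (i , u) g _ eq = let v , u∼v , ¬g = CK-witness u j g eq
                            in (i , v) , B.R-block j i u v (λ g _ → u∼v g) , ¬g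

  module Branch (s : ℕ → Bool) where

    state : ∀ k → State k
    state zero    = start
    state (suc k) = Step.next (state k) (s k)

    D∞ : ℕ → Entry
    D∞ i = D (state i) i

    D-stable : ∀ {i k} → i ≤′ k → D (state k) i ≡ D∞ i
    D-stable ≤′-refl = refl
    D-stable {i} {suc k} (≤′-step i≤k) =
      trans (sym (update-≤ (D (state k)) k _ i (≤′⇒≤ i≤k))) (D-stable i≤k)

    module M = Blocks D∞ (λ _ → true)

    k≤bound : ∀ k → k ≤ bound (state k)
    k≤bound zero    = z≤n
    k≤bound (suc k) = ≤-trans (s≤s (k≤bound k)) (Step.bound-grows (state k) (s k))

    bound-mono : ∀ {k l} → k ≤′ l → bound (state k) ≤ bound (state l)
    bound-mono ≤′-refl = ≤-refl
    bound-mono {l = suc l} (≤′-step k≤l) =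
      ≤-trans (bound-mono k≤l) (<⇒≤ (Step.bound-grows (state l) (s l)))

    sat-stable : ∀ {k l} → k ≤′ l → ∀ g x → proj₁ x ≤ k → depth g ≤ bound (state k) →
                 satₛ (state l) x g ≡ satₛ (state k) x g
    sat-stable ≤′-refl g x _ _ = refl
    sat-stable {l = suc l} (≤′-step k≤l) g x x≤k d = trans
      (Step.Ap.sat-old (state l) (s l) g x (≤-trans x≤k (≤′⇒≤ k≤l))
        (≤-trans d (≤-trans (bound-mono k≤l) (Step.bound≤κ (state l) (s l)))))
      (sat-stable k≤l g x x≤k d)

    -- Locality replaces the limit by stage `k + depth g`, since `g` sees no further block from `x`;
    -- stability then leads back to stage `k`, whose bound protects `g` from all later blocks.
    sat-limit : ∀ k g x → proj₁ x ≤ k → depth g ≤ bound (state k) → M.sat x g ≡ satₛ (state k) x g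
    sat-limit k g x x≤k d = trans
      (sat-local D∞ (D (state l)) (λ _ → true) (upTo l) l (λ i i≤l → sym (D-stable (≤⇒≤′ i≤l)))
        (λ i i<l → sym (⌊⌋-true i<l)) g x (+-monoˡ-≤ (depth g) x≤k))
      (sat-stable (≤⇒≤′ (m≤m+n k (depth g))) g x x≤k d)
      where
      l = k + depth g

    deep∞ : ∀ i → depth f ≤ level (D∞ i)
    deep∞ i = deep (state i) i

    all-f : ∀ x → M.sat x f ≡ true
    all-f x = trans (sat-limit (proj₁ x) f x ≤-refl (wide (state (proj₁ x)))) (good (state (proj₁ x)) x)

    -- Block `suc (depth g)` is appended to the state with index `depth g`, whose bound is already
    -- at least `depth g`; so its worlds decide `g` as their points do. Density follows.
    realised : ∀ (u : CK) g → M.sat (suc (depth g) , u) g ≡ val (proj₁ u) g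
    realised u g = trans
      (sat-limit (suc k) g (suc k , u) ≤-refl (≤-trans (k≤bound k) (<⇒≤ (Step.bound-grows (state k) (s k)))))
      (Step.Ap.sat-new (state k) (s k) g (suc k , u) 1+n≰n
        (≤-trans (k≤bound k) (Step.bound≤κ (state k) (s k))))
      where
      k = depth g

    rootTheory : Ω m (2+ n)
    rootTheory = M.th root

    cell : Subset m (2+ n)
    cell = Image M.N

    cell-isCell : IsCell cell
    cell-isCell = image-isCell M.N M.fanout root λ (i , u) → M.connected deep∞ i u λ _ _ → refl

    cell-finiteFanout : FiniteFanout cell
    cell-finiteFanout = image-finiteFanout M.N M.fanout

    cell-dense : cell DenseIn Ck f
    cell-dense = image-dense M.N (λ x → proj₂ (thCK M.N all-f x))
      λ z g z∈Ck eq → (suc (depth g) , z , z∈Ck) , trans (realised (z , z∈Ck) g) eq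

    root∈cell : cell rootTheory
    root∈cell = root , λ _ → refl

  open Branch

  step-injective : ∀ {k} {S S′ : State k} {b b′} → S ≡ S′ →
    (∀ g → depth g ≤ bound (Step.next S b) → depth g ≤ bound (Step.next S′ b′) →
      satₛ (Step.next S b) root g ≡ satₛ (Step.next S′ b′) root g) → b ≡ b′
  step-injective {S = S} {b = b} {b′} refl same = Step.next-separates S b b′ λ g d → same g d d

  -- The formula `difference` depends on the state, so the roots reveal choice `k` only once the two
  -- states at `k` are known to be equal; hence the mutual recursion.
  states-agree : ∀ s t → rootTheory s ≋ rootTheory t → ∀ k → state s k ≡ state t k
  choices-agree : ∀ s t → rootTheory s ≋ rootTheory t → ∀ k → s k ≡ t k

  states-agree s t eq zero    = refl
  states-agree s t eq (suc k) = cong₂ Step.next (states-agree s t eq k) (choices-agree s t eq k)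

  choices-agree s t eq k = step-injective (states-agree s t eq k) λ g d d′ → trans
    (sym (sat-limit s (suc k) g root z≤n d)) (trans (sym (M.val-th s root g)) (trans (eq g)
      (trans (M.val-th t root g) (sat-limit t (suc k) g root z≤n d′))))

-- Overlapping cells, codes of paths, and the Cantor-Schröder-Bernstein theorem

cells-meet : {C C′ : Subset m n} → IsCell C → IsCell C′ → ∀ {x} → C x → C′ x → C ⊆ C′
cells-meet {C = C} {C′} isC isC′ x∈C x∈C′ z∈C =
  proj₂ (IsCell.minimal isC (C ∩ C′) (_ , x∈C , x∈C′)
    (λ j P P∈ (x , x∈P , x∈C , x∈C′) y∈P →
      IsCell.saturated isC j P P∈ (x , x∈P , x∈C) y∈P , IsCell.saturated isC′ j P P∈ (x , x∈P , x∈C′) y∈P)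
    proj₁ z∈C)

codes : List (Fin n × ℒ m n) → ℕ
codes []            = 0
codes ((j , g) ∷ c) = suc (pair (toℕ j) (pair (code g) (codes c)))

codes-injective : (c c′ : List (Fin n × ℒ m n)) → codes c ≡ codes c′ → c ≡ c′
codes-injective [] [] _ = refl
codes-injective ((j , g) ∷ c) ((j′ , g′) ∷ c′) eq
  with p , q ← pair-injective (suc-injective eq)
  with q , r ← pair-injective q =
  cong₂ _∷_ (cong₂ _,_ (toℕ-injective p) (code-injective g g′ q)) (codes-injective c c′ r)

module CantorSchröderBernstein (em : ∀ {ℓ} → ExcludedMiddle ℓ)
  {a ℓ b ℓ′} {A : Setoid a ℓ} {B : Setoid b ℓ′} (F : Func A B) (G : Func B A)
  (F-injective : ∀ {x y} → Setoid._≈_ B (Func.to F x) (Func.to F y) → Setoid._≈_ A x y)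
  (G-injective : ∀ {x y} → Setoid._≈_ A (Func.to G x) (Func.to G y) → Setoid._≈_ B x y)
  where
  open Classical em
  private
    module A = Setoid A
    module B = Setoid B
    module F = Func F
    module G = Func G

  -- The orbits under G ∘ F of the points outside the range of G.
  data Stem : A.Carrier → Set (a ⊔ˡ ℓ ⊔ˡ b) where
    base : ∀ {x} → (∀ y → ¬ G.to y A.≈ x) → Stem x
    step : ∀ {x x′} → Stem x → G.to (F.to x) A.≈ x′ → Stem x′

  stem-resp : ∀ {x x′} → x A.≈ x′ → Stem x → Stem x′
  stem-resp eq (base ∉G)  = base λ y Gy≈x → ∉G y (A.trans Gy≈x (A.sym eq))
  stem-resp eq (step s p) = step s (A.trans p eq)

  preimage : ∀ {x} → ¬ Stem x → ∃ λ y → G.to y A.≈ x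
  preimage ¬s = dne λ ¬∃ → ¬s (base λ y eq → ¬∃ (y , eq))

  to : A.Carrier → B.Carrier
  to x with em {P = Stem x}
  ... | yes _ = F.to x
  ... | no ¬s = proj₁ (preimage ¬s)

  to-stem : ∀ {x} → Stem x → to x B.≈ F.to x
  to-stem {x} s with em {P = Stem x}
  ... | yes _ = B.refl
  ... | no ¬s = ⊥-elim (¬s s)

  to-other : ∀ {x} → ¬ Stem x → G.to (to x) A.≈ x
  to-other {x} ¬s with em {P = Stem x}
  ... | yes s = ⊥-elim (¬s s)
  ... | no ¬s = proj₂ (preimage ¬s)

  to-cong : ∀ {x y} → x A.≈ y → to x B.≈ to y
  to-cong {x} {y} eq = go (em {P = Stem x})
    where
    go : Dec (Stem x) → to x B.≈ to y
    go (yes s) = B.trans (to-stem s) (B.trans (F.cong eq) (B.sym (to-stem (stem-resp eq s))))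
    go (no ¬s) = G-injective (A.trans (to-other ¬s) (A.trans eq
                   (A.sym (to-other (¬s ∘ stem-resp (A.sym eq))))))

  to-injective : ∀ {x y} → to x B.≈ to y → x A.≈ y
  to-injective {x} {y} eq = go (em {P = Stem x}) (em {P = Stem y})
    where
    go : Dec (Stem x) → Dec (Stem y) → x A.≈ y
    go (yes s) (yes t) = F-injective (B.trans (B.sym (to-stem s)) (B.trans eq (to-stem t)))
    go (no ¬s) (no ¬t) = A.trans (A.sym (to-other ¬s)) (A.trans (G.cong eq) (to-other ¬t))
    go (yes s) (no ¬t) = ⊥-elim (¬t (step s
      (A.trans (G.cong (B.trans (B.sym (to-stem s)) eq)) (to-other ¬t))))
    go (no ¬s) (yes t) = ⊥-elim (¬s (step t
      (A.trans (G.cong (B.trans (B.sym (to-stem t)) (B.sym eq))) (to-other ¬s))))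

  to-surjective : ∀ y → ∃ λ x → to x B.≈ y
  to-surjective y = go (em {P = Stem (G.to y)})
    where
    go : Dec (Stem (G.to y)) → ∃ λ x → to x B.≈ y
    go (yes (base ∉G))        = ⊥-elim (∉G y A.refl)
    go (yes (step {x} s eq)) = x , B.trans (to-stem s) (G-injective eq)
    go (no ¬s)                = G.to y , G-injective (to-other ¬s)

  bijection : Bijection A B
  bijection = record
    { to        = to
    ; cong      = to-cong
    ; bijective = to-injective ,
        λ y → let x , eq = to-surjective y in x , λ z≈x → B.trans (to-cong z≈x) eq
    }

-- Countability of cells with finite fanout, and infinity of `Ck f`

module Reachability (em : ∀ {ℓ} → ExcludedMiddle ℓ) {m n : ℕ} (f : ℒ m (2+ n)) where
  open Classical em
  open Generation em f

  Path : Set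
  Path = List (Agent × ℒ m (2+ n))

  -- z is reached from r along a path each of whose points is the only one
  -- of its possibility set that contains a given formula.
  Reach : Ω m (2+ n) → Path → Ω m (2+ n) → Set₁
  Reach r []            z = Lift 1ℓ (r ≋ z)
  Reach r ((j , g) ∷ c) z = ∃ λ x → Reach r c x ×
    (∀ h → val x (K j h) ≡ val z (K j h)) × val z g ≡ true ×
    (∀ y → (∀ h → val x (K j h) ≡ val y (K j h)) → val y g ≡ true → y ≋ z)

  -- A path determines its endpoint, so once a root is fixed, the points reached from it are no more
  -- numerous than the countably many paths.
  reach-unique : ∀ {r r′} c {z z′} → r ≋ r′ → Reach r c z → Reach r′ c z′ → z ≋ z′
  reach-unique [] r≋r′ (lift p) (lift q) g = trans (sym (p g)) (trans (r≋r′ g) (q g))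
  reach-unique {r} {r′} ((j , g) ∷ c) {z} r≋r′ (x , p , x∼z , zg , _) (x′ , p′ , _ , _ , only) =
    only z (λ h → trans (sym (reach-unique {r} {r′} c {x} {x′} r≋r′ p p′ (K j h))) (x∼z h)) zg

  isolate : ∀ (z : Ω m (2+ n)) ts → ∃ λ g → val z g ≡ true ×
            (∀ y → Any (y ≋_) ts → val y g ≡ true → z ≋ y)
  isolate z ts =
    let P?           = λ t → em {P = ¬ z ≋ t}
        g , zg , sep = separate f z (filter P? ts) (All.all-filter P? ts)
    in g , zg , λ y any yg → dne λ z≉y →
      let t , t∈ts , y≋t = find any
          t∈ts′ = ∈-filter⁺ P? t∈ts λ z≋t → z≉y λ h → trans (z≋t h) (sym (y≋t h))
      in case trans (sym (All.lookup sep t∈ts′)) (trans (sym (y≋t g)) yg) of λ ()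

  respects : {C : Subset m (2+ n)} → IsCell C → ∀ {u v} → u ≋ v → C u → C v
  respects {C} isC {u} {v} u≋v u∈C = saturated-∼ {D = C} (IsCell.saturated isC) zero u∈C
    (val⇒∼ⱼ {z = u} {v} λ g → u≋v (K zero g))

  opaque
    -- The reached points of the cell form a saturated set: each possibility set met is finite, so a
    -- formula isolates any chosen point of it and prolongs the path. Minimality of the cell does
    -- the rest.
    reachable : {C : Subset m (2+ n)} → IsCell C → FiniteFanout C → ∀ {r z} → C r → C z →
                ∃ λ c → Reach r c z
    reachable {C} isC fin {r} r∈C z∈C =
      proj₂ (IsCell.minimal isC D (r , r∈C , [] , lift λ _ → refl) sat proj₁ z∈C)
      where
      D : Subset m (2+ n)
      D z = C z × ∃ λ c → Reach r c z
      sat : Saturated D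
      sat j P P∈𝒬@(x₀ , P⊆ , ⊆P) (x , x∈P , x∈C , c , reach) {y} y∈P =
        let P⊆C = λ {z} → IsCell.saturated isC j P P∈𝒬 (x , x∈P , x∈C) {z}
            zs , finite  = fin j P P∈𝒬 P⊆C
            g , yg , iso = isolate y zs
            ∼y = λ z (z∈P : P z) h → trans (sym (∼ⱼ⇒val {z = x₀} {x} (P⊆ x∈P) h)) (∼ⱼ⇒val {z = x₀} {z} (P⊆ z∈P) h)
        in P⊆C y∈P , (j , g) ∷ c , x , reach , ∼y y y∈P , yg , λ z x∼z zg h → sym (iso z
             (Any.map (λ {t} → ≈⇒≋ {z = z} {t}) (Equivalence.to (finite z) (⊆P (val⇒∼ⱼ {z = x₀} {z} λ h →
               trans (∼ⱼ⇒val {z = x₀} {x} (P⊆ x∈P) h) (x∼z h))))) zg h)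

  -- Were `Ck f` finite, a formula would isolate each of its points, so that a dense cell would have
  -- to contain all of them and two dense cells could not differ.
  dense-finite : (ts : List (Ω m (2+ n))) → (∀ z → Ck f z → Any (z ≋_) ts) →
                 {C C′ : Subset m (2+ n)} → C DenseIn Ck f → IsCell C′ → C′ DenseIn Ck f → C ⊆ C′
  dense-finite ts cover {C} {C′} (C⊆ , _) isC′ (C′⊆ , dense) {z} z∈C =
    let g , zg , iso           = isolate z ts
        y , lift y∋g , y∈C′ = dense (λ y → Lift 1ℓ (⟦ y ⟧ g)) (λ y (lift y∋g) → g , y∋g , lift)
                                (z , lift (true-⌊⌋ zg) , C⊆ z∈C)
    in respects isC′ {y} {z} (λ h → sym (iso y (cover y (C′⊆ y∈C′)) (⌊⌋-true y∋g) h)) y∈C′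

  infinitely-many : Generative f → (ts : List (Ω m (2+ n))) →
                    ∃ λ (u : CK) → All (λ t → ¬ proj₁ u ≋ t) ts
  infinitely-many gen ts = dne λ ¬∃ →
    let C , C′ , (isC , dC) , (isC′ , dC′) , C≠C′ = Generative.twoDenseCells gen
        cover : ∀ z → Ck f z → Any (z ≋_) ts
        cover z z∈Ck = dne λ ¬any → ¬∃ ((z , z∈Ck) , All.¬Any⇒All¬ ts ¬any)
    in C≠C′ ((λ {z} → dense-finite ts cover dC isC′ dC′ {z}) ,
             λ {z} → dense-finite ts cover dC′ isC dC {z})

-- Counting the cells

module Continuum (em : ∀ {ℓ} → ExcludedMiddle ℓ) (ac : ∀ {a b c d} → AxiomOfChoice a b c d)
  {m n : ℕ} (f : ℒ m (2+ n))
  (cellOf : (ℕ → Bool) → Setoid.Carrier (FiniteFanoutDenseCells f))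
  (pointOf : (ℕ → Bool) → Ω m (2+ n))
  (pointOf∈ : ∀ s → proj₁ (cellOf s) (pointOf s))
  (pointOf-injective : ∀ s t → Classical._≋_ em (pointOf s) (pointOf t) → ∀ k → s k ≡ t k)
  where
  open Classical em
  open Generation em f
  open Reachability em f

  Cells : Setoid (lsuc 1ℓ) 1ℓ
  Cells = FiniteFanoutDenseCells f

  private
    module Cells = Setoid Cells

  Cantor : Setoid 0ℓ 0ℓ
  Cantor = ℕ →-setoid Bool

  -- A section of `forget` selects a root for each cell. As equality here compares the roots too,
  -- congruence of the section makes the root depend on the cell alone and not on its presentation.
  Rooted : Setoid (lsuc 1ℓ) 1ℓ
  Rooted = record
    { Carrier       = ∃ λ (C : Cells.Carrier) → ∃ (proj₁ C)
    ; _≈_           = λ (C , z , _) (C′ , z′ , _) → C Cells.≈ C′ × z ≋ z′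
    ; isEquivalence = record
      { refl  = λ {(C , _)} → Cells.refl {C} , λ _ → refl
      ; sym   = λ {(C , _)} {(C′ , _)} (p , q) → Cells.sym {C} {C′} p , λ g → sym (q g)
      ; trans = λ {(C , _)} {(C′ , _)} {(C″ , _)} (p , q) (p′ , q′) →
                  Cells.trans {C} {C′} {C″} p p′ , λ g → trans (q g) (q′ g)
      }
    }

  forget : Surjection Rooted Cells
  forget = record
    { to         = proj₁
    ; cong       = proj₁
    ; surjective = λ C → (C , IsCell.nonEmpty (proj₁ (proj₂ C))) , proj₁
    }

  chooseRoot : Func Cells Rooted
  chooseRoot = proj₁ (ac forget)

  rootOf : Cells.Carrier → Ω m (2+ n)
  rootOf C = proj₁ (proj₂ (Func.to chooseRoot C))

  rootOf-cong : ∀ C C′ → C Cells.≈ C′ → rootOf C ≋ rootOf C′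
  rootOf-cong C C′ eq = proj₂ (Func.cong chooseRoot {C} {C′} eq)

  rootOf∈ : ∀ C → proj₁ C (rootOf C)
  rootOf∈ C = proj₁ (proj₂ (ac forget) C) (proj₂ (proj₂ (Func.to chooseRoot C)))

  rootOf-injective : ∀ C C′ → rootOf C ≋ rootOf C′ → C Cells.≈ C′
  rootOf-injective C@(_ , isC , _) C′@(_ , isC′ , _) eq =
    (λ {z} → cells-meet isC isC′ (rootOf∈ C)
      (respects isC′ {rootOf C′} {rootOf C} (λ g → sym (eq g)) (rootOf∈ C′)) {z}) ,
    (λ {z} → cells-meet isC′ isC (rootOf∈ C′)
      (respects isC {rootOf C} {rootOf C′} eq (rootOf∈ C)) {z})

  -- A sequence is read as a two-dimensional array with one row for each path.
  row : Path → (ℕ → Bool) → ℕ → Bool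
  row c s k = s (pair (codes c) k)

  At : Path → (ℕ → Bool) → Set₁
  At c s = Reach (rootOf (cellOf s)) c (pointOf s)

  At-unique : ∀ c {s t} → At c s → At c t → cellOf s Cells.≈ cellOf t → ∀ k → s k ≡ t k
  At-unique c {s} {t} p q eq = pointOf-injective s t
    (reach-unique {rootOf (cellOf s)} {rootOf (cellOf t)} c {pointOf s} {pointOf t}
      (rootOf-cong (cellOf s) (cellOf t) eq) p q)

  Hit : ℕ → Set
  Hit N = ∃₂ λ (c : Path) k → pair (codes c) k ≡ N
  entryAt : ∀ {N} → (Path → ℕ → Bool) → Dec (Hit N) → Bool
  entryAt y (yes (c , k , _)) = y c k
  -- An arbitrary default: such an index belongs to no row.
  entryAt y (no _)            = false
  diagonal : (Path → ℕ → Bool) → ℕ → Bool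
  diagonal y N = entryAt y (em {P = Hit N})
  entryAt-hit : ∀ y c k (d : Dec (Hit (pair (codes c) k))) → entryAt y d ≡ y c k
  entryAt-hit y c k (no ¬hit) = ⊥-elim (¬hit (c , k , refl))
  entryAt-hit y c k (yes (c′ , k′ , eq)) with p , q ← pair-injective eq =
    cong₂ y (codes-injective c′ c p) q
  row-diagonal : ∀ y c k → row c (diagonal y) k ≡ y c k
  row-diagonal y c k = entryAt-hit y c k em

  located : ∀ s → ∃ λ c → At c s
  located s = let _ , isC , fin , _ = cellOf s in
    reachable isC fin (rootOf∈ (cellOf s)) (pointOf∈ s)

  Onto : Path → (ℕ → Bool) → Set₁
  Onto c y = ∃ λ s → At c s × (∀ k → row c s k ≡ y k)

  -- König's diagonal argument: a cell contains countably many of the roots,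
  -- so if no row at a fixed position were onto, a sequence with missing
  -- values in all of its rows would have no position in its cell.
  diagonal-argument : ∀ y → ¬ (∀ c → ¬ Onto c (y c))
  diagonal-argument y missed =
    let c , at = located (diagonal y) in missed c (diagonal y , at , row-diagonal y c)

  opaque
    full-row : ∃ λ c → ∀ y → Onto c y
    full-row = dne λ ¬∃ →
      let missing = λ c → ¬∀⇒∃¬ λ onto → ¬∃ (c , onto)
      in diagonal-argument (λ c → proj₁ (missing c)) (λ c → proj₂ (missing c))

  position : Path
  position = proj₁ full-row

  Positioned : Setoid 1ℓ 1ℓ
  Positioned = record
    { Carrier       = ∃ (At position)
    ; _≈_           = λ (s , _) (t , _) → cellOf s Cells.≈ cellOf t
    ; isEquivalence = record
      { refl  = λ {(s , _)} → Cells.refl {cellOf s}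
      ; sym   = λ {(s , _)} {(t , _)} → Cells.sym {cellOf s} {cellOf t}
      ; trans = λ {(s , _)} {(t , _)} {(u , _)} → Cells.trans {cellOf s} {cellOf t} {cellOf u}
      }
    }

  -- By `At-unique` the row at the fixed position is a function of the cell, and by `full-row` it
  -- takes every value. A section of this surjection therefore sends different sequences to
  -- different cells.
  readRow : Surjection Positioned Cantor
  readRow = record
    { to         = λ (s , _) → row position s
    ; cong       = λ {x} {y} → row-cong {x} {y}
    ; surjective = λ y → let s , at , eq = proj₂ full-row y in
        (s , at) , λ {t} t≈s k → trans (row-cong {t} {s , at} t≈s k) (eq k)
    }
    where
    row-cong : {x y : ∃ (At position)} → cellOf (proj₁ x) Cells.≈ cellOf (proj₁ y) →
               ∀ k → row position (proj₁ x) k ≡ row position (proj₁ y) k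
    row-cong {s , p} {t , q} eq k = At-unique position {s} {t} p q eq _

  fromCantor : Func Cantor Cells
  fromCantor = record
    { to   = λ y → cellOf (proj₁ (Func.to (proj₁ (ac readRow)) y))
    ; cong = λ {x} {y} → Func.cong (proj₁ (ac readRow)) {x} {y}
    }

  fromCantor-injective : ∀ {x y} → Func.to fromCantor x Cells.≈ Func.to fromCantor y → ∀ k → x k ≡ y k
  fromCantor-injective {x} {y} eq k = trans (sym (proj₂ (ac readRow) x k))
    (trans (Surjection.cong readRow {Func.to (proj₁ (ac readRow)) x} {Func.to (proj₁ (ac readRow)) y} eq k)
      (proj₂ (ac readRow) y k))

  member : Ω m (2+ n) → ℕ → Bool
  member z k = ⌊ (∃ λ g → code g ≡ k × ⟦ z ⟧ g) ⌋

  member-code : ∀ z g → member z (code g) ≡ val z g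
  member-code z g = ⌊⌋-cong
    (λ (h , eq , h∈z) → subst ⟦ z ⟧ (code-injective h g eq) h∈z) (λ g∈z → g , refl , g∈z)

  -- Cells sharing a point coincide, so a cell is determined by its root, and the root by the set of
  -- codes of its formulas.
  toCantor : Func Cells Cantor
  toCantor = record
    { to   = λ C → member (rootOf C)
    ; cong = λ {C} {C′} eq k →
        let ⊆′ , ⊇′ = ≋⇒≈ {z = rootOf C} {rootOf C′} (rootOf-cong C C′ eq) in
        ⌊⌋-cong (λ (g , p , q) → g , p , ⊆′ q) (λ (g , p , q) → g , p , ⊇′ q)
    }

  toCantor-injective : ∀ {C C′} → (∀ k → member (rootOf C) k ≡ member (rootOf C′) k) → C Cells.≈ C′
  toCantor-injective {C} {C′} eq = rootOf-injective C C′ λ g →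
    trans (sym (member-code (rootOf C) g)) (trans (eq (code g)) (member-code (rootOf C′) g))

  bijection : HasCardinalityContinuum Cells
  bijection = CantorSchröderBernstein.bijection em fromCantor toCantor
    (λ {x} {y} → fromCantor-injective {x} {y}) (λ {C} {C′} → toCantor-injective {C} {C′})

theorem2 : (∀ {ℓ} → ExcludedMiddle ℓ) →
    (∀ {a b c d} → AxiomOfChoice a b c d) →
    (m n : ℕ) (f : ℒ m n) → Generative f →
    HasCardinalityContinuum (FiniteFanoutDenseCells f)
theorem2 em ac m n f gen with s≤s (s≤s _) ← Generative.twoAgents gen =
  Continuum.bijection em ac f
    (λ s → Branch.cell s , Branch.cell-isCell s , Branch.cell-finiteFanout s , Branch.cell-dense s)
    Branch.rootTheory Branch.root∈cell choices-agree
  where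
  open Reachability em f
  open Generation em f
  open Construction em f
    (λ k d≤k → Base.chain (proj₂ (Generative.semanticallyClosed gen)) (Generative.connected gen) k (≤⇒≤′ d≤k))
    (infinitely-many gen)
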